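{- Let $q$ be an odd prime power, let $d$ be odd, let $i \in \{3,4\}$, let $n,m$ be positive integers and let $r \in \mathbb{F}_q^\times$. Define \[I^\Delta_r(n,m) = \max\left|I(P,S) - q^{ -1}|P|\,|S|\right|,\] where the maximum is over all $P \subseteq \mathbb{F}_q^d$ with $|P| = n$ and all sets $S$ of $Q_i^d$-spheres each of radius $r$ with $|S| = m$. Then \[I^\Delta_r(n,m) < 3\,q^{(d-1)/2}m^{1/2}n^{1/2}.\]
   Context: $\mathbb{F}_q$ is the finite field with $q$ elements and $\mathbb{F}_q^\times=\mathbb{F}_q\setminus\{0\}$. Fix a non-square $\epsilon\in\mathbb{F}_q$. For odd $d$, define quadratic forms on $\mathbb{F}_q^d$ by $Q_3^d(x) = x_1x_2 + x_3x_4 + \cdots + x_{d-2}x_{d-1} - x_d^2$ and $Q_4^d(x) = x_1x_2 + x_3x_4 + \cdots + x_{d-2}x_{d-1} - \epsilon x_d^2$. For a quadratic form $Q$, the $Q$-sphere with center $y$ and radius $r$ is $\{x \in \mathbb{F}_q^d : Q(x-y) = r\}$; a sphere is specified by its center and radius. For $P \subseteq \mathbb{F}_q^d$ and a set $S$ of spheres, $I(P,S) = \#\{(x,s) \in P \times S : x \in s\}$. -}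

module Defs where

open import Level using (0ℓ)
open import Data.Nat using (ℕ; zero; suc)
open import Data.List using (List; length; filter; map)
open import Data.Nat.ListAction using (sum)
open import Data.List.Membership.Propositional using (_∈_)
open import Data.List.Relation.Unary.Unique.Propositional using (Unique)
open import Data.Vec using (Vec; []; _∷_; zipWith)
open import Data.Product using (∃)
open import Relation.Binary.Definitions using (DecidableEquality)
open import Relation.Binary.PropositionalEquality using (_≡_)
open import Relation.Nullary using (¬_)
open import Algebra.Structures using (IsCommutativeRing)

record FiniteField : Set₁ where
  infixl 7 _*_
  infixl 6 _+_
  field
    Carrier : Set
    _≟_     : DecidableEquality Carrier
    _+_ _*_ : Carrier → Carrier → Carrier
    -_      : Carrier → Carrier
    0# 1#   : Carrier
    isCommutativeRing : IsCommutativeRing _≡_ _+_ _*_ -_ 0# 1#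
    0≢1     : ¬ (0# ≡ 1#)
    inverse : ∀ x → ¬ (x ≡ 0#) → ∃ λ y → x * y ≡ 1#
    elements : List Carrier
    elements-unique : Unique elements
    elements-complete : ∀ x → x ∈ elements

  size : ℕ
  size = length elements

dbl : ℕ → ℕ
dbl zero = zero
dbl (suc k) = suc (suc (dbl k))

module _ (F : FiniteField) where
  open FiniteField F

  Point : ℕ → Set
  Point k = Vec Carrier (suc (dbl k))

  Qc : (k : ℕ) → Carrier → Point k → Carrier
  Qc zero c (x ∷ []) = - (c * (x * x))
  Qc (suc k) c (x ∷ y ∷ v) = x * y + Qc k c v

  -- Q_3^d (coefficient 1) and Q_4^d (coefficient ε), selected by i ∈ {3,4}.
  coeff : (ε : Carrier) → ℕ → Carrier
  coeff ε 3 = 1#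
  coeff ε _ = ε

  Q : (k : ℕ) → (ε : Carrier) → (i : ℕ) → Point k → Carrier
  Q k ε i = Qc k (coeff ε i)

  vsub : {k : ℕ} → Point k → Point k → Point k
  vsub x y = zipWith (λ a b → a + (- b)) x y

  -- I(P,S) where S is the set of Q-spheres of radius r with the given centers:
  -- number of pairs (x, y) with x ∈ P, y ∈ centers, Q(x - y) = r.
  incidences : (k : ℕ) → (ε : Carrier) → (i : ℕ) → (r : Carrier) →
               List (Point k) → List (Point k) → ℕ
  incidences k ε i r P centers =
    sum (map (λ x → length (filter (λ y → Q k ε i (vsub x y) ≟ r) centers)) P)

{-# OPTIONS --safe #-}
module Submission where

-- Let Q be the form and B its polar form, let p = q^k, and let σ = ±1 record whether -rc is a
-- square, where c is the coefficient of the last variable. The cone {(ξ , u) : u² = r Q(ξ)}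
-- plays the role of the Fourier transform of the sphere {Q = r}: a count of its sections by the
-- hyperplanes B(ξ , w) = 2u gives, for every w,
--
--   Σ_{(ξ , u) in the cone} (q [B(ξ , w) = 2u] - 1)  =  σ (q - 1) p (q [Q(w) = r] - 1).
--
-- Summed over w = x - y with x ∈ P and y ∈ centers, the right-hand side is a multiple of
-- q I - nm, while the left-hand side correlates the centred numbers of points of P and of
-- centers on the hyperplanes B(ξ , _) = s. Since at most two u lie above each ξ, Cauchy–Schwarz
-- and Parseval for these numbers bound |q I - nm| by 2 q^{k+1} √(nm). No characters are needed.

-- The cone comes from a closed formula. In odd dimension the Fourier coefficient of the sphere at a
-- nonzero ξ is, up to a constant, a Salié sum with parameter r Q(ξ). Unlike a Kloosterman sum, it
-- evaluates to a Gauss sum times the sum of ψ(2u) over the roots of u² = r Q(ξ); hence the 2u in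
-- the hyperplanes. The cone is stable under scaling of (ξ , u), so testing with whole families of
-- parallel hyperplanes instead of a single character ψ only repeats each frequency q - 1 times.
-- This factor enters both sides of the final inequality and cancels. The crux is that a linear
-- section of the cone must detect Q(w) = r. Diagonalising the section leaves a quadric with a new
-- variable z whose coefficient is proportional to r - Q(w): it degenerates exactly when w lies on
-- the sphere. Otherwise its number of points is exactly the expected one, and no error term has to
-- be estimated before Cauchy-Schwarz. The sign σ never needs to be known, since the discrepancy is
-- squared and only σ² = 1 enters.

open import Defs

-- A ring solver with integer coefficients over any commutative ring.

module IntegerCoefficients where
  open import Algebra using (CommutativeRing)
  open import Algebra.Solver.Ring.AlmostCommutativeRing
  open import Data.Integer as ℤ using (ℤ; +_; -[1+_]; _⊖_)
  import Data.Integer.Properties as ℤ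
  open import Data.Maybe using (Maybe; just; nothing)
  open import Data.Nat as ℕ using (ℕ; zero; suc)
  import Data.Nat.Properties as ℕ
  open import Relation.Nullary using (yes; no)
  open import Relation.Binary.PropositionalEquality as ≡ using (_≡_)
  import Algebra.Solver.Ring as RingSolver

  module _ {c ℓ} (R : CommutativeRing c ℓ) where
    open CommutativeRing R
    open import Algebra.Properties.Semiring.Mult.TCOptimised semiring
    open import Algebra.Properties.Ring ring
    open import Algebra.Properties.AbelianGroup +-abelianGroup
    open import Algebra.Properties.CommutativeSemigroup +-commutativeSemigroup using (interchange)
    open import Relation.Binary.Reasoning.Setoid setoid

    fromℤ : ℤ → Carrier
    fromℤ (+ n)    = n × 1#
    fromℤ -[1+ n ] = - (suc n × 1#)

    fromℤ-neg : ∀ i → fromℤ (ℤ.- i) ≈ - fromℤ i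
    fromℤ-neg (+ zero)  = sym -0#≈0#
    fromℤ-neg (+ suc n) = refl
    fromℤ-neg -[1+ n ]  = sym (-‿involutive _)

    suc-× : ∀ n → suc n × 1# ≈ 1# + n × 1#
    suc-× n = ×-homo-+ 1# 1 n

    fromℤ-⊖ : ∀ m n → fromℤ (m ⊖ n) ≈ m × 1# - n × 1#
    fromℤ-⊖ zero    zero    = sym (-‿inverseʳ 0#)
    fromℤ-⊖ zero    (suc n) = sym (+-identityˡ _)
    fromℤ-⊖ (suc m) zero    = sym (trans (+-congˡ -0#≈0#) (+-identityʳ _))
    fromℤ-⊖ (suc m) (suc n) = begin
      fromℤ (suc m ⊖ suc n)                   ≡⟨ ≡.cong fromℤ (ℤ.[1+m]⊖[1+n]≡m⊖n m n) ⟩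
      fromℤ (m ⊖ n)                           ≈⟨ fromℤ-⊖ m n ⟩
      m × 1# - n × 1#                         ≈⟨ +-identityˡ _ ⟨
      0# + (m × 1# - n × 1#)                  ≈⟨ +-congʳ (-‿inverseʳ 1#) ⟨
      (1# - 1#) + (m × 1# - n × 1#)           ≈⟨ interchange _ _ _ _ ⟩
      (1# + m × 1#) + (- 1# - n × 1#)         ≈⟨ +-congˡ (⁻¹-∙-comm _ _) ⟩
      (1# + m × 1#) - (1# + n × 1#)           ≈⟨ +-cong (suc-× m) (-‿cong (suc-× n)) ⟨
      suc m × 1# - suc n × 1#                 ∎

    fromℤ-+ : ∀ i j → fromℤ (i ℤ.+ j) ≈ fromℤ i + fromℤ j
    fromℤ-+ (+ m)    (+ n)    = ×-homo-+ 1# m n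
    fromℤ-+ (+ m)    -[1+ n ] = fromℤ-⊖ m (suc n)
    fromℤ-+ -[1+ m ] (+ n)    = trans (fromℤ-⊖ n (suc m)) (+-comm _ _)
    fromℤ-+ -[1+ m ] -[1+ n ] = begin
      - (suc (suc (m ℕ.+ n)) × 1#)            ≡⟨ ≡.cong (λ k → - (suc k × 1#)) (ℕ.+-suc m n) ⟨
      - ((suc m ℕ.+ suc n) × 1#)              ≈⟨ -‿cong (×-homo-+ 1# (suc m) (suc n)) ⟩
      - (suc m × 1# + suc n × 1#)             ≈⟨ ⁻¹-∙-comm _ _ ⟨
      - (suc m × 1#) - suc n × 1#             ∎

    fromℤ-pos-* : ∀ m j → fromℤ (+ m ℤ.* j) ≈ m × 1# * fromℤ j
    fromℤ-pos-* m (+ n) = trans (reflexive (≡.cong fromℤ (≡.sym (ℤ.pos-* m n)))) (×1-homo-* m n)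
    fromℤ-pos-* m -[1+ n ] = begin
      fromℤ (+ m ℤ.* ℤ.- (+ suc n))           ≡⟨ ≡.cong fromℤ (ℤ.neg-distribʳ-* (+ m) (+ suc n)) ⟨
      fromℤ (ℤ.- (+ m ℤ.* + suc n))           ≈⟨ fromℤ-neg (+ m ℤ.* + suc n) ⟩
      - fromℤ (+ m ℤ.* + suc n)               ≈⟨ -‿cong (fromℤ-pos-* m (+ suc n)) ⟩
      - (m × 1# * suc n × 1#)                 ≈⟨ -‿distribʳ-* _ _ ⟩
      m × 1# * - (suc n × 1#)                 ∎

    fromℤ-* : ∀ i j → fromℤ (i ℤ.* j) ≈ fromℤ i * fromℤ j
    fromℤ-* (+ m)    j = fromℤ-pos-* m j
    fromℤ-* -[1+ m ] j = begin
      fromℤ (ℤ.- (+ suc m) ℤ.* j)             ≡⟨ ≡.cong fromℤ (ℤ.neg-distribˡ-* (+ suc m) j) ⟨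
      fromℤ (ℤ.- (+ suc m ℤ.* j))             ≈⟨ fromℤ-neg (+ suc m ℤ.* j) ⟩
      - fromℤ (+ suc m ℤ.* j)                 ≈⟨ -‿cong (fromℤ-pos-* (suc m) j) ⟩
      - (suc m × 1# * fromℤ j)                ≈⟨ -‿distribˡ-* _ _ ⟩
      - (suc m × 1#) * fromℤ j                ∎

    fromℤ-morphism : ℤ.+-*-rawRing -Raw-AlmostCommutative⟶ fromCommutativeRing R
    fromℤ-morphism = record
      { ⟦_⟧    = fromℤ
      ; +-homo = fromℤ-+
      ; *-homo = fromℤ-*
      ; -‿homo = fromℤ-neg
      ; 0-homo = refl
      ; 1-homo = refl
      }

    -- Distinct integers may have equal images in positive characteristic; answering `nothing` there
    -- is sound and only makes the solver weaker.
    fromℤ-≟ : ∀ i j → Maybe (fromℤ i ≈ fromℤ j)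
    fromℤ-≟ i j with i ℤ.≟ j
    ... | yes e = just (reflexive (≡.cong fromℤ e))
    ... | no _  = nothing

    module Solver = RingSolver ℤ.+-*-rawRing (fromCommutativeRing R) fromℤ-morphism fromℤ-≟

-- Ordered ring of integers with an opaque product.

module OpaqueIntegers where
  -- Integer multiplication unfolds to signs and absolute values as soon as it is compared with
  -- another term, which defeats the inference of implicit arguments; hence the opaque copy.
  open import Algebra using (CommutativeRing)
  open import Algebra.Structures using (IsCommutativeRing)
  open import Data.Integer as ℤ public using (ℤ; +_; -[1+_]; _+_; _-_; -_; 0ℤ; 1ℤ; Positive; _≤_; +≤+)
  import Data.Integer.Properties as ℤ
  open import Data.Integer.Properties public
    using (≤-refl; ≤-reflexive; ≤-trans; ≤-antisym; +-mono-≤; +-monoʳ-≤; +-monoˡ-≤; 0≤i-j⇒j≤i; i≤j⇒0≤j-i)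
  open import Data.Nat as ℕ using (ℕ; z≤n)
  open import Relation.Binary.PropositionalEquality using (_≡_; refl; subst)
  open IntegerCoefficients

  infixl 7 _*_

  opaque
    _*_ : ℤ → ℤ → ℤ
    i * j = i ℤ.* j

  opaque
    unfolding _*_

    *-unfold : ∀ i j → i * j ≡ i ℤ.* j
    *-unfold i j = refl

    isCommutativeRing : IsCommutativeRing _≡_ _+_ _*_ -_ 0ℤ 1ℤ
    isCommutativeRing = ℤ.+-*-isCommutativeRing

    pos-* : ∀ m n → + (m ℕ.* n) ≡ + m * + n
    pos-* = ℤ.pos-*

    square-nonneg : ∀ i → 0ℤ ≤ i * i
    square-nonneg (+ n)    = subst (0ℤ ≤_) (ℤ.pos-* n n) (+≤+ z≤n)
    square-nonneg -[1+ n ] = +≤+ z≤n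

    *-cancelˡ-≤ : ∀ k → Positive k → ∀ {i j} → k * i ≤ k * j → i ≤ j
    *-cancelˡ-≤ k k>0 {i} {j} = ℤ.*-cancelˡ-≤-pos i j k {{k>0}}

    *-positive : ∀ {i j} → Positive i → Positive j → Positive (i * j)
    *-positive {+ ℕ.suc _} {+ ℕ.suc _} _ _ = _

    *-monoˡ-≤ : ∀ {i j} n → 0ℤ ≤ n → i ≤ j → i * n ≤ j * n
    *-monoˡ-≤ (+ n) _ = ℤ.*-monoʳ-≤-nonNeg (+ n)

    *-mono-≤ : ∀ {i j k l} → 0ℤ ≤ k → 0ℤ ≤ j → i ≤ j → k ≤ l → i * k ≤ j * l
    *-mono-≤ {i} {+ j} {+ k} _ _ i≤j k≤l = ≤-trans
      (ℤ.*-monoʳ-≤-nonNeg (+ k) i≤j) (ℤ.*-monoˡ-≤-nonNeg (+ j) k≤l)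

  open IsCommutativeRing isCommutativeRing public
    using (+-assoc; +-comm; +-identityˡ; +-identityʳ; *-comm; *-identityˡ; *-identityʳ; distribˡ; zeroˡ; zeroʳ)

  commutativeRing : CommutativeRing _ _
  commutativeRing = record { isCommutativeRing = isCommutativeRing }

  open Solver commutativeRing public using (solve; con; _:+_; _:*_; _:-_; :-_; _:=_)

-- Finite integer sums, Cauchy-Schwarz and indicator functions.

module IntegerSums where
  open OpaqueIntegers
  import Data.Nat as ℕ
  open import Data.List using (List; []; _∷_; _++_; map; length; filter; cartesianProduct)
  open import Data.List.Membership.Propositional using (_∈_)
  open import Data.List.Relation.Unary.Any using (here; there)
  open import Data.List.Relation.Unary.All as All using (All; []; _∷_)
  open import Data.List.Relation.Unary.AllPairs using ([]; _∷_)
  open import Data.List.Relation.Unary.Unique.Propositional using (Unique)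
  import Data.Nat.ListAction as ListAction
  open import Data.Product using (_,_)
  open import Data.Empty using (⊥-elim)
  open import Relation.Nullary using (¬_; Dec; yes; no)
  open import Relation.Unary using (Decidable)
  open import Relation.Binary.Definitions using (DecidableEquality)
  open import Relation.Binary.PropositionalEquality

  private variable
    A B : Set
    P P′ : Set

  ∑ : List A → (A → ℤ) → ℤ
  ∑ []       f = 0ℤ
  ∑ (x ∷ xs) f = f x + ∑ xs f

  ∑-cong : ∀ (xs : List A) {f g} → (∀ x → f x ≡ g x) → ∑ xs f ≡ ∑ xs g
  ∑-cong []       e = refl
  ∑-cong (x ∷ xs) e = cong₂ _+_ (e x) (∑-cong xs e)

  ∑-+ : ∀ (xs : List A) f g → ∑ xs (λ x → f x + g x) ≡ ∑ xs f + ∑ xs g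
  ∑-+ []       f g = refl
  ∑-+ (x ∷ xs) f g = trans (cong (_+_ (f x + g x)) (∑-+ xs f g)) (solve 4 (λ a b c d → (a :+ b) :+ (c :+ d) := (a :+ c) :+ (b :+ d)) refl (f x) (g x) _ _)

  ∑-*ˡ : ∀ (xs : List A) c f → ∑ xs (λ x → c * f x) ≡ c * ∑ xs f
  ∑-*ˡ []       c f = sym (zeroʳ c)
  ∑-*ˡ (x ∷ xs) c f = trans (cong (_+_ (c * f x)) (∑-*ˡ xs c f)) (sym (distribˡ c (f x) _))

  ∑-*ʳ : ∀ (xs : List A) f c → ∑ xs (λ x → f x * c) ≡ ∑ xs f * c
  ∑-*ʳ xs f c = trans (∑-cong xs λ x → *-comm (f x) c) (trans (∑-*ˡ xs c f) (*-comm c _))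

  ∑-const : ∀ (xs : List A) c → ∑ xs (λ _ → c) ≡ + length xs * c
  ∑-const []       c = sym (zeroˡ c)
  ∑-const (x ∷ xs) c = trans (cong (_+_ c) (∑-const xs c)) (1+length xs c)

    where
    1+length : ∀ (xs : List A) c → c + + length xs * c ≡ + ℕ.suc (length xs) * c
    1+length xs c = solve 2 (λ n c → c :+ n :* c := (con (+ 1) :+ n) :* c) refl (+ length xs) c

  ∑-*+const : ∀ (xs : List A) b f c → ∑ xs (λ x → b * f x + c) ≡ b * ∑ xs f + + length xs * c
  ∑-*+const xs b f c = trans (∑-+ xs _ _) (cong₂ _+_ (∑-*ˡ xs b f) (∑-const xs c))

  ∑-*∑ : ∀ (xs : List A) (ys : List B) f g → ∑ xs f * ∑ ys g ≡ ∑ xs (λ x → ∑ ys λ y → f x * g y)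
  ∑-*∑ xs ys f g = trans (sym (∑-*ʳ xs f _)) (∑-cong xs λ x → sym (∑-*ˡ ys (f x) g))

  ∑-0 : ∀ (xs : List A) → ∑ xs (λ _ → 0ℤ) ≡ 0ℤ
  ∑-0 xs = trans (∑-const xs 0ℤ) (zeroʳ (+ length xs))

  ∑-swap : ∀ (xs : List A) (ys : List B) (f : A → B → ℤ) →
           ∑ xs (λ x → ∑ ys (f x)) ≡ ∑ ys (λ y → ∑ xs λ x → f x y)
  ∑-swap []       ys f = sym (∑-0 ys)
  ∑-swap (x ∷ xs) ys f = trans (cong (_+_ (∑ ys (f x))) (∑-swap xs ys f)) (sym (∑-+ ys (f x) _))

  ∑-mono : ∀ (xs : List A) {f g} → (∀ x → f x ≤ g x) → ∑ xs f ≤ ∑ xs g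
  ∑-mono []       h = ≤-refl
  ∑-mono (x ∷ xs) h = +-mono-≤ (h x) (∑-mono xs h)

  ∑-nonneg : ∀ (xs : List A) {f} → (∀ x → 0ℤ ≤ f x) → 0ℤ ≤ ∑ xs f
  ∑-nonneg xs {f} h = subst (_≤ ∑ xs f) (∑-0 xs) (∑-mono xs h)

  -- Serves as the pigeonhole principle: a termwise bound whose total is attained must be attained
  -- in every term.
  ∑-nonneg-vanishes : ∀ {xs : List A} {f} → (∀ x → 0ℤ ≤ f x) → ∑ xs f ≡ 0ℤ →
                      ∀ {x} → x ∈ xs → f x ≡ 0ℤ
  ∑-nonneg-vanishes {xs = x ∷ xs} {f} h e (here refl) = ≤-antisym
    (subst (f x ≤_) e (subst (_≤ f x + ∑ xs f) (+-identityʳ (f x)) (+-monoʳ-≤ (f x) (∑-nonneg xs h))))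
    (h x)
  ∑-nonneg-vanishes {xs = x ∷ xs} {f} h e (there i) = ∑-nonneg-vanishes h
    (≤-antisym
      (subst (∑ xs f ≤_) e (subst (_≤ f x + ∑ xs f) (+-identityˡ (∑ xs f)) (+-monoˡ-≤ (∑ xs f) (h x))))
      (∑-nonneg xs h)) i

  ∑-map : ∀ (h : A → B) xs f → ∑ (map h xs) f ≡ ∑ xs (λ x → f (h x))
  ∑-map h []       f = refl
  ∑-map h (x ∷ xs) f = cong (_+_ (f (h x))) (∑-map h xs f)

  ∑-++ : ∀ (xs ys : List A) f → ∑ (xs ++ ys) f ≡ ∑ xs f + ∑ ys f
  ∑-++ []       ys f = sym (+-identityˡ _)
  ∑-++ (x ∷ xs) ys f = trans (cong (_+_ (f x)) (∑-++ xs ys f)) (sym (+-assoc (f x) _ _))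

  ∑-cartesianProduct : ∀ (xs : List A) (ys : List B) f →
                       ∑ (cartesianProduct xs ys) f ≡ ∑ xs (λ x → ∑ ys λ y → f (x , y))
  ∑-cartesianProduct []       ys f = refl
  ∑-cartesianProduct (x ∷ xs) ys f = trans (∑-++ (map (x ,_) ys) _ f)
    (cong₂ _+_ (∑-map (x ,_) ys f) (∑-cartesianProduct xs ys f))

  -- Lagrange's identity: the defect is half of a double sum of squares.
  cauchy-schwarz : ∀ (xs : List A) (f g : A → ℤ) →
    ∑ xs (λ x → f x * g x) * ∑ xs (λ x → f x * g x) ≤
    ∑ xs (λ x → f x * f x) * ∑ xs (λ x → g x * g x)
  cauchy-schwarz xs f g = *-cancelˡ-≤ (+ 2) _
    (0≤i-j⇒j≤i (subst (0ℤ ≤_) lagrange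
      (∑-nonneg xs λ x → ∑-nonneg xs λ y → square-nonneg (f x * g y - f y * g x))))
    where
    X = ∑ xs (λ x → f x * f x)
    Y = ∑ xs (λ x → g x * g x)
    Z = ∑ xs (λ x → f x * g x)

    combine : ∀ a b c u v w → ∑ xs (λ y → a * u y + b * v y + c * w y) ≡ a * ∑ xs u + b * ∑ xs v + c * ∑ xs w
    combine a b c u v w = trans (∑-+ xs _ _) (cong₂ _+_
      (trans (∑-+ xs _ _) (cong₂ _+_ (∑-*ˡ xs a u) (∑-*ˡ xs b v))) (∑-*ˡ xs c w))

    expand : ∀ a b c d → (a * d - c * b) * (a * d - c * b) ≡
             (a * a) * (d * d) + (- (+ 2) * (a * b)) * (c * d) + (b * b) * (c * c)
    expand = solve 4 (λ a b c d → (a :* d :- c :* b) :* (a :* d :- c :* b) :=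
             (a :* a) :* (d :* d) :+ (:- con (+ 2) :* (a :* b)) :* (c :* d) :+ (b :* b) :* (c :* c)) refl

    regroup : ∀ X Y Z a b c → a * Y + (- (+ 2) * b) * Z + c * X ≡ Y * a + (- (+ 2) * Z) * b + X * c
    regroup = solve 6 (λ X Y Z a b c → a :* Y :+ (:- con (+ 2) :* b) :* Z :+ c :* X :=
              Y :* a :+ (:- con (+ 2) :* Z) :* b :+ X :* c) refl

    collect : ∀ X Y Z → Y * X + (- (+ 2) * Z) * Z + X * Y ≡ + 2 * (X * Y) - + 2 * (Z * Z)
    collect = solve 3 (λ X Y Z → Y :* X :+ (:- con (+ 2) :* Z) :* Z :+ X :* Y :=
              con (+ 2) :* (X :* Y) :- con (+ 2) :* (Z :* Z)) refl

    lagrange : ∑ xs (λ x → ∑ xs λ y → (f x * g y - f y * g x) * (f x * g y - f y * g x)) ≡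
               + 2 * (X * Y) - + 2 * (Z * Z)
    lagrange = trans
      (∑-cong xs λ x → trans
        (∑-cong xs λ y → expand (f x) (g x) (f y) (g y))
        (trans (combine (f x * f x) (- (+ 2) * (f x * g x)) (g x * g x) _ _ _)
               (regroup X Y Z (f x * f x) (f x * g x) (g x * g x))))
      (trans (combine Y (- (+ 2) * Z) X _ _ _) (collect X Y Z))

  ι : Dec P → ℤ
  ι (yes _) = 1ℤ
  ι (no _)  = 0ℤ

  ι-yes : (d : Dec P) → P → ι d ≡ 1ℤ
  ι-yes (yes _) p = refl
  ι-yes (no ¬p) p = ⊥-elim (¬p p)

  ι-no : (d : Dec P) → ¬ P → ι d ≡ 0ℤ
  ι-no (yes p) ¬p = ⊥-elim (¬p p)
  ι-no (no _)  ¬p = refl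

  ι-cong : (d : Dec P) (d′ : Dec P′) → (P → P′) → (P′ → P) → ι d ≡ ι d′
  ι-cong (yes p) d′ f g = sym (ι-yes d′ (f p))
  ι-cong (no ¬p) d′ f g = sym (ι-no d′ λ p′ → ¬p (g p′))

  ι-*-idem : (d : Dec P) → ι d * ι d ≡ ι d
  ι-*-idem (yes _) = *-identityˡ 1ℤ
  ι-*-idem (no _)  = zeroˡ 0ℤ

  ∑-filter : ∀ {Q : A → Set} (Q? : Decidable Q) xs → + length (filter Q? xs) ≡ ∑ xs (λ x → ι (Q? x))
  ∑-filter Q? [] = refl
  ∑-filter Q? (x ∷ xs) with Q? x
  ... | yes _ = cong (_+_ 1ℤ) (∑-filter Q? xs)
  ... | no _  = trans (∑-filter Q? xs) (sym (+-identityˡ _))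

  ∑-sum : ∀ (f : A → ℕ.ℕ) xs → + ListAction.sum (map f xs) ≡ ∑ xs (λ x → + f x)
  ∑-sum f []       = refl
  ∑-sum f (x ∷ xs) = cong (_+_ (+ f x)) (∑-sum f xs)

  module _ (_≟_ : DecidableEquality A) where

    ∑-δ-∉ : ∀ {xs c} → All (λ x → ¬ c ≡ x) xs → ∀ (f : A → ℤ) → ∑ xs (λ a → ι (a ≟ c) * f a) ≡ 0ℤ
    ∑-δ-∉ []       f = refl
    ∑-δ-∉ (n ∷ ns) f = trans (cong₂ _+_ (cong (_* f _) (ι-no (_ ≟ _) λ e → n (sym e))) (∑-δ-∉ ns f)) (trans (+-identityʳ _) (zeroˡ _))

    ∑-δ-∈ : ∀ {xs c} → Unique xs → c ∈ xs → ∀ (f : A → ℤ) → ∑ xs (λ a → ι (a ≟ c) * f a) ≡ f c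
    ∑-δ-∈ {c = c} (n ∷ u) (here refl) f = trans
      (cong₂ _+_ (cong (_* f c) (ι-yes (c ≟ c) refl)) (∑-δ-∉ n f))
      (trans (+-identityʳ _) (*-identityˡ _))
    ∑-δ-∈ {c = c} (n ∷ u) (there i) f = trans
      (cong₂ _+_ (trans (cong (_* f _) (ι-no (_ ≟ c) (All.lookup n i))) (zeroˡ _)) (∑-δ-∈ u i f))
      (+-identityˡ _)

    ∑-diagonal : ∀ {xs} → Unique xs → ∑ xs (λ x → ∑ xs λ y → ι (y ≟ x)) ≡ + length xs
    ∑-diagonal {xs} u = trans (go (λ i → i)) (trans (∑-const xs 1ℤ) (*-identityʳ _))
      where
      -- Only the outer list varies in the induction; the inner one stays `xs`, in which each
      -- element occurs exactly once.
      go : ∀ {ys} → (∀ {x} → x ∈ ys → x ∈ xs) → ∑ ys (λ x → ∑ xs λ y → ι (y ≟ x)) ≡ ∑ ys (λ _ → 1ℤ)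
      go {[]}     s = refl
      go {y ∷ ys} s = cong₂ _+_
        (trans (∑-cong xs λ _ → sym (*-identityʳ _)) (∑-δ-∈ u (s (here refl)) λ _ → 1ℤ))
        (go λ i → s (there i))

    module Enumeration (xs : List A) (unique : Unique xs) (complete : ∀ x → x ∈ xs) where

      ∑-δ : ∀ c (f : A → ℤ) → ∑ xs (λ a → ι (a ≟ c) * f a) ≡ f c
      ∑-δ c = ∑-δ-∈ unique (complete c)

      ∑-δ-count : ∀ c → ∑ xs (λ a → ι (a ≟ c)) ≡ 1ℤ
      ∑-δ-count c = trans (∑-cong xs λ _ → sym (*-identityʳ _)) (∑-δ c λ _ → 1ℤ)

      -- Inserting a Kronecker delta and exchanging the sums gives the change of variables without
      -- showing that `map h xs` is a permutation of `xs`.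
      ∑-reindex : ∀ (h h⁻¹ : A → A) → (∀ a → h (h⁻¹ a) ≡ a) → (∀ a → h⁻¹ (h a) ≡ a) →
                  ∀ (f : A → ℤ) → ∑ xs (λ a → f (h a)) ≡ ∑ xs f
      ∑-reindex h h⁻¹ hh⁻¹ h⁻¹h f = trans
        (∑-cong xs λ a → sym (∑-δ (h a) f))
        (trans (∑-swap xs xs _) (∑-cong xs λ b → trans (∑-*ʳ xs _ (f b))
          (trans (cong (_* f b) (trans
            (∑-cong xs λ a → ι-cong (b ≟ h a) (a ≟ h⁻¹ b)
              (λ e → trans (sym (h⁻¹h a)) (cong h⁻¹ (sym e)))
              (λ e → trans (sym (hh⁻¹ b)) (cong h (sym e))))
            (∑-δ-count (h⁻¹ b)))) (*-identityˡ (f b)))))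

-- Counting solutions of equations over a finite field.

module FieldCounting (F : FiniteField) where
  open import Algebra using (CommutativeRing)
  open import Data.List.Membership.Propositional using (lose)
  open import Data.List.Relation.Unary.Any using (any?; satisfied)
  open import Data.Nat as ℕ using (z≤n; s≤s)
  open import Data.Product using (∃; _,_)
  open import Data.Sum using (_⊎_; inj₁; inj₂; [_,_]′)
  open import Data.Empty using (⊥-elim)
  open import Relation.Nullary using (¬_; Dec; yes; no)
  open import Relation.Binary.PropositionalEquality
  open IntegerCoefficients using (module Solver)
  open OpaqueIntegers
  open IntegerSums

  open FiniteField F public
    renaming (_≟_ to infix 4 _≟_; _+_ to infixl 6 _⊕_; _*_ to infixl 7 _⊗_; -_ to infix 8 ⊖_; isCommutativeRing to 𝔽-isCommutativeRing)

  𝔽-commutativeRing : CommutativeRing _ _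
  𝔽-commutativeRing = record { isCommutativeRing = 𝔽-isCommutativeRing }

  open Solver 𝔽-commutativeRing public using ()
    renaming (solve to 𝔽-solve; con to 𝔽-con; _:+_ to infixl 7 _⊞_; _:*_ to infixl 8 _⊠_; :-_ to infix 9 ⊟_; _:=_ to infix 4 _≋_)

  open Enumeration _≟_ elements elements-unique elements-complete public
  module 𝔽 = CommutativeRing 𝔽-commutativeRing

  q : ℤ
  q = + size

  ∑𝔽 : (Carrier → ℤ) → ℤ
  ∑𝔽 = ∑ elements

  difference-zero : ∀ {x y} → x ⊕ ⊖ y ≡ 0# → x ≡ y
  difference-zero {x} {y} e = trans
    (𝔽-solve 2 (λ x y → x ≋ (x ⊞ ⊟ y) ⊞ y) refl x y)
    (trans (cong (_⊕ y) e) (𝔽.+-identityˡ y))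

  ⊗-cancelˡ : ∀ {x y z} → x ≢ 0# → x ⊗ y ≡ x ⊗ z → y ≡ z
  ⊗-cancelˡ {x} {y} {z} x≢0 e with inverse x x≢0
  ... | x⁻¹ , xx⁻¹ = trans (sym (undo y)) (trans (cong (_⊗ x⁻¹) e) (undo z))
    where
    undo : ∀ y → x ⊗ y ⊗ x⁻¹ ≡ y
    undo y = trans (𝔽-solve 3 (λ x y i → x ⊠ y ⊠ i ≋ x ⊠ i ⊠ y) refl x y x⁻¹)
      (trans (cong (_⊗ y) xx⁻¹) (𝔽.*-identityˡ y))

  zero-product : ∀ {x y} → x ⊗ y ≡ 0# → x ≡ 0# ⊎ y ≡ 0#
  zero-product {x} {y} e with x ≟ 0#
  ... | yes x≡0 = inj₁ x≡0
  ... | no x≢0  = inj₂ (⊗-cancelˡ x≢0 (trans e (sym (𝔽.zeroʳ x))))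

  ⊗-≢0 : ∀ {x y} → x ≢ 0# → y ≢ 0# → x ⊗ y ≢ 0#
  ⊗-≢0 x≢0 y≢0 e = [ x≢0 , y≢0 ]′ (zero-product e)

  square-zero : ∀ {x} → x ⊗ x ≡ 0# → x ≡ 0#
  square-zero e = [ (λ p → p) , (λ p → p) ]′ (zero-product e)

  ⊖-≢0 : ∀ {x} → x ≢ 0# → ⊖ x ≢ 0#
  ⊖-≢0 {x} x≢0 e = x≢0 (trans (𝔽-solve 1 (λ x → x ≋ ⊟ ⊟ x) refl x)
    (trans (cong ⊖_ e) (𝔽-solve 0 (⊟ 𝔽-con 0ℤ ≋ 𝔽-con 0ℤ) refl)))

  ∑𝔽-const : ∀ c → ∑𝔽 (λ _ → c) ≡ q * c
  ∑𝔽-const = ∑-const elements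

  ∑𝔽-translate : ∀ c f → ∑𝔽 (λ a → f (a ⊕ c)) ≡ ∑𝔽 f
  ∑𝔽-translate c = ∑-reindex (_⊕ c) (_⊕ ⊖ c)
    (λ a → 𝔽-solve 2 (λ a c → (a ⊞ ⊟ c) ⊞ c ≋ a) refl a c)
    (λ a → 𝔽-solve 2 (λ a c → (a ⊞ c) ⊞ ⊟ c ≋ a) refl a c)

  ∑𝔽-scale : ∀ {c} → c ≢ 0# → ∀ f → ∑𝔽 (λ a → f (c ⊗ a)) ≡ ∑𝔽 f
  ∑𝔽-scale {c} c≢0 with inverse c c≢0
  ... | c⁻¹ , cc⁻¹ = ∑-reindex (c ⊗_) (c⁻¹ ⊗_)
    (λ a → trans (sym (𝔽.*-assoc c c⁻¹ a)) (trans (cong (_⊗ a) cc⁻¹) (𝔽.*-identityˡ a)))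
    (λ a → trans (𝔽-solve 3 (λ c i a → i ⊠ (c ⊠ a) ≋ (c ⊠ i) ⊠ a) refl c c⁻¹ a)
      (trans (cong (_⊗ a) cc⁻¹) (𝔽.*-identityˡ a)))

  ∑𝔽-unique : ∀ {P : Carrier → Set} (P? : ∀ a → Dec (P a)) c → P c → (∀ a → P a → a ≡ c) →
              ∑𝔽 (λ a → ι (P? a)) ≡ 1ℤ
  ∑𝔽-unique {P} P? c Pc u = trans
    (∑-cong elements λ a → ι-cong (P? a) (a ≟ c) (u a) λ e → subst P (sym e) Pc)
    (∑-δ-count c)

  ∑𝔽-linear : ∀ {c} → c ≢ 0# → ∀ s → ∑𝔽 (λ a → ι (c ⊗ a ≟ s)) ≡ 1ℤ
  ∑𝔽-linear c≢0 s = trans (∑𝔽-scale c≢0 (λ a → ι (a ≟ s))) (∑-δ-count s)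

  ∑𝔽-none : ∀ {P : Carrier → Set} (P? : ∀ a → Dec (P a)) → (∀ a → ¬ P a) → ∑𝔽 (λ a → ι (P? a)) ≡ 0ℤ
  ∑𝔽-none P? n = trans (∑-cong elements λ a → ι-no (P? a) (n a)) (∑-0 elements)

  -- Every row with `a` nonzero contains exactly one solution; the row of zero contains the whole
  -- field if `s` is zero and nothing otherwise.
  hyperbola-count : ∀ s → ∑𝔽 (λ a → ∑𝔽 λ b → ι (a ⊗ b ≟ s)) ≡ (q - 1ℤ) + q * ι (s ≟ 0#)
  hyperbola-count s = trans (∑-cong elements row) (trans
    (∑-*+const elements (q * ι (s ≟ 0#) - 1ℤ) (λ a → ι (a ≟ 0#)) 1ℤ)
    (trans (cong (λ z → (q * ι (s ≟ 0#) - 1ℤ) * z + q * 1ℤ) (∑-δ-count 0#))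
      (solve 2 (λ q i → (q :* i :- con 1ℤ) :* con 1ℤ :+ q :* con 1ℤ := (q :- con 1ℤ) :+ q :* i)
        refl q (ι (s ≟ 0#)))))
    where
    row : ∀ a → ∑𝔽 (λ b → ι (a ⊗ b ≟ s)) ≡ (q * ι (s ≟ 0#) - 1ℤ) * ι (a ≟ 0#) + 1ℤ
    row a with a ≟ 0#
    ... | no a≢0 = trans (∑𝔽-linear a≢0 s)
      (solve 1 (λ x → con 1ℤ := x :* con 0ℤ :+ con 1ℤ) refl (q * ι (s ≟ 0#) - 1ℤ))
    ... | yes refl = trans
      (∑-cong elements λ b → ι-cong (0# ⊗ b ≟ s) (s ≟ 0#)
        (λ e → trans (sym e) (𝔽.zeroˡ b)) (λ e → trans (𝔽.zeroˡ b) (sym e)))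
      (trans (∑𝔽-const _) (solve 1 (λ x → x := (x :- con 1ℤ) :* con 1ℤ :+ con 1ℤ) refl _))

  -- In odd characteristic this is one plus the quadratic character of `t`, which therefore needs no
  -- separate definition.
  roots : Carrier → ℤ
  roots t = ∑𝔽 λ u → ι (u ⊗ u ≟ t)

  square? : ∀ t → (∃ λ y → y ⊗ y ≡ t) ⊎ (∀ y → y ⊗ y ≢ t)
  square? t with any? (λ y → y ⊗ y ≟ t) elements
  ... | yes p = inj₁ (satisfied p)
  ... | no ¬p = inj₂ λ y e → ¬p (lose (elements-complete y) e)

  roots-nonsquare : ∀ {t} → (∀ y → y ⊗ y ≢ t) → roots t ≡ 0ℤ
  roots-nonsquare n = ∑𝔽-none _ n

  roots-0 : roots 0# ≡ 1ℤ
  roots-0 = ∑𝔽-unique _ 0# (𝔽.zeroˡ 0#) λ _ → square-zero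

  roots-scale : ∀ {c} → c ≢ 0# → ∀ t → roots (c ⊗ c ⊗ t) ≡ roots t
  roots-scale {c} c≢0 t = trans
    (sym (∑𝔽-scale c≢0 λ u → ι (u ⊗ u ≟ c ⊗ c ⊗ t)))
    (∑-cong elements λ u → ι-cong ((c ⊗ u) ⊗ (c ⊗ u) ≟ c ⊗ c ⊗ t) (u ⊗ u ≟ t)
      (λ e → ⊗-cancelˡ (⊗-≢0 c≢0 c≢0) (trans (rearrange u) e))
      (λ e → trans (sym (rearrange u)) (cong (c ⊗ c ⊗_) e)))
    where
    rearrange : ∀ u → c ⊗ c ⊗ (u ⊗ u) ≡ (c ⊗ u) ⊗ (c ⊗ u)
    rearrange u = 𝔽-solve 2 (λ c u → c ⊠ c ⊠ (u ⊠ u) ≋ (c ⊠ u) ⊠ (c ⊠ u)) refl c u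

  ∑-roots : ∑𝔽 roots ≡ q
  ∑-roots = trans (∑-swap elements elements _) (trans
    (∑-cong elements λ u → ∑𝔽-unique (λ t → u ⊗ u ≟ t) (u ⊗ u) refl λ _ → sym)
    (trans (∑𝔽-const 1ℤ) (*-identityʳ q)))

  -- In characteristic two squaring is injective, hence onto.
  nonsquare⇒2≢0 : ∀ {ν} → (∀ y → y ⊗ y ≢ ν) → 1# ⊕ 1# ≢ 0#
  -- The defects `1 - roots t` would all be nonnegative with sum zero, yet the defect at `ν` is one.
  nonsquare⇒2≢0 {ν} nonsquare 2≡0 = absurd (trans (sym defect-ν) (∑-nonneg-vanishes
    {f = λ t → 1ℤ - roots t} defect-nonneg total (elements-complete ν)))
    where
    absurd : 1ℤ ≢ 0ℤ
    absurd ()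

    double-zero : ∀ x → x ⊕ x ≡ 0#
    double-zero x = trans (𝔽-solve 1 (λ x → x ⊞ x ≋ x ⊠ (𝔽-con 1ℤ ⊞ 𝔽-con 1ℤ)) refl x)
      (trans (cong (x ⊗_) 2≡0) (𝔽.zeroʳ x))

    root-unique : ∀ y a → a ⊗ a ≡ y ⊗ y → a ≡ y
    root-unique y a e = difference-zero (square-zero (trans
      (𝔽-solve 2 (λ a y → (a ⊞ ⊟ y) ⊠ (a ⊞ ⊟ y) ≋
        (a ⊠ a ⊞ ⊟ (y ⊠ y)) ⊞ (y ⊠ (y ⊞ ⊟ a) ⊞ y ⊠ (y ⊞ ⊟ a))) refl a y)
      (trans (cong₂ _⊕_ (trans (cong (_⊕ ⊖ (y ⊗ y)) e) (𝔽.-‿inverseʳ _)) (double-zero _))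
        (𝔽.+-identityˡ 0#))))

    defect-nonneg : ∀ t → 0ℤ ≤ 1ℤ - roots t
    defect-nonneg t with square? t
    ... | inj₂ n = subst (λ z → 0ℤ ≤ 1ℤ - z) (sym (roots-nonsquare n)) (+≤+ z≤n)
    ... | inj₁ (y , refl) = subst (λ z → 0ℤ ≤ 1ℤ - z)
      (sym (∑𝔽-unique (λ u → u ⊗ u ≟ y ⊗ y) y refl (root-unique y))) (+≤+ z≤n)

    defect-ν : 1ℤ - roots ν ≡ 1ℤ
    defect-ν = cong (λ z → 1ℤ - z) (roots-nonsquare nonsquare)

    total : ∑𝔽 (λ t → 1ℤ - roots t) ≡ 0ℤ
    total = trans
      (∑-cong elements λ t → solve 1 (λ x → con 1ℤ :- x := :- con 1ℤ :* x :+ con 1ℤ) refl (roots t))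
      (trans (∑-*+const elements (- 1ℤ) roots 1ℤ)
        (trans (cong (λ z → - 1ℤ * z + q * 1ℤ) ∑-roots)
          (solve 1 (λ q → :- con 1ℤ :* q :+ q :* con 1ℤ := con 0ℤ) refl q)))

  -- Square roots and ternary quadrics in odd characteristic.

  module OddCharacteristic (2≢0 : 1# ⊕ 1# ≢ 0#) where

    double-≢0 : ∀ {x} → x ≢ 0# → x ⊕ x ≢ 0#
    double-≢0 {x} x≢0 e = ⊗-≢0 x≢0 2≢0
      (trans (𝔽-solve 1 (λ x → x ⊠ (𝔽-con 1ℤ ⊞ 𝔽-con 1ℤ) ≋ x ⊞ x) refl x) e)

    roots-square : ∀ {y} → y ≢ 0# → roots (y ⊗ y) ≡ + 2
    roots-square {y} y≢0 = trans (∑-cong elements split) (trans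
      (∑-+ elements _ _) (cong₂ _+_ (∑-δ-count y) (∑-δ-count (⊖ y))))
      where
      y≢⊖y : y ≢ ⊖ y
      y≢⊖y e = double-≢0 y≢0 (trans (cong (y ⊕_) e) (𝔽.-‿inverseʳ y))

      split : ∀ u → ι (u ⊗ u ≟ y ⊗ y) ≡ ι (u ≟ y) + ι (u ≟ ⊖ y)
      split u with u ≟ y | u ≟ ⊖ y
      ... | yes refl | yes e    = ⊥-elim (y≢⊖y e)
      ... | yes refl | no _     = ι-yes (y ⊗ y ≟ y ⊗ y) refl
      ... | no _     | yes refl = ι-yes (⊖ y ⊗ ⊖ y ≟ y ⊗ y)
        (𝔽-solve 1 (λ y → ⊟ y ⊠ ⊟ y ≋ y ⊠ y) refl y)
      ... | no u≢y   | no u≢⊖y  = ι-no (u ⊗ u ≟ y ⊗ y) λ e →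
        [ (λ p → u≢y (difference-zero p))
        , (λ p → u≢⊖y (difference-zero (trans (cong (u ⊕_) (𝔽-solve 1 (λ y → ⊟ ⊟ y ≋ y) refl y)) p)))
        ]′ (zero-product (trans
          (𝔽-solve 2 (λ u y → (u ⊞ ⊟ y) ⊠ (u ⊞ y) ≋ u ⊠ u ⊞ ⊟ (y ⊠ y)) refl u y)
          (trans (cong (_⊕ ⊖ (y ⊗ y)) e) (𝔽.-‿inverseʳ _))))

    root-≢0 : ∀ {y t} → t ≢ 0# → y ⊗ y ≡ t → y ≢ 0#
    root-≢0 t≢0 e refl = t≢0 (trans (sym e) (𝔽.zeroˡ 0#))

    roots-≤2 : ∀ t → roots t ≤ + 2
    roots-≤2 t with square? t | t ≟ 0#
    ... | _               | yes refl = subst (_≤ + 2) (sym roots-0) (+≤+ (s≤s z≤n))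
    ... | inj₂ n          | no _     = subst (_≤ + 2) (sym (roots-nonsquare n)) (+≤+ z≤n)
    ... | inj₁ (y , refl) | no t≢0   = ≤-reflexive (roots-square (root-≢0 t≢0 refl))

    -- The left-hand side is at most 2 for every t, and its average over t is 2.
    roots-nonsquare-multiple : ∀ {ν} → (∀ y → y ⊗ y ≢ ν) → ∀ t → roots t + roots (ν ⊗ t) ≡ + 2
    roots-nonsquare-multiple {ν} nonsquare t = trans
      (solve 1 (λ x → x := con (+ 2) :- (con (+ 2) :- x)) refl _)
      (cong (_-_ (+ 2)) (∑-nonneg-vanishes {f = λ t → + 2 - (roots t + roots (ν ⊗ t))}
        defect-nonneg total (elements-complete t)))
      where
      ν≢0 : ν ≢ 0#
      ν≢0 e = nonsquare 0# (trans (𝔽.zeroˡ 0#) (sym e))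

      -- Otherwise `z ⊗ y⁻¹` would be a square root of `ν`.
      quotient-square : ∀ {y z} → y ≢ 0# → z ⊗ z ≢ ν ⊗ (y ⊗ y)
      quotient-square {y} {z} y≢0 e with inverse y y≢0
      ... | y⁻¹ , yy⁻¹ = nonsquare (z ⊗ y⁻¹) (⊗-cancelˡ (⊗-≢0 y≢0 y≢0) (trans
        (𝔽-solve 3 (λ y z i → y ⊠ y ⊠ (z ⊠ i ⊠ (z ⊠ i)) ≋ (y ⊠ i) ⊠ (y ⊠ i) ⊠ (z ⊠ z)) refl y z y⁻¹)
        (trans (cong₂ (λ a b → a ⊗ a ⊗ b) yy⁻¹ e)
          (𝔽-solve 2 (λ ν y → 𝔽-con 1ℤ ⊠ 𝔽-con 1ℤ ⊠ (ν ⊠ (y ⊠ y)) ≋ y ⊠ y ⊠ ν) refl ν y))))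

      defect-nonneg : ∀ t → 0ℤ ≤ + 2 - (roots t + roots (ν ⊗ t))
      defect-nonneg t with square? t | t ≟ 0#
      ... | _ | yes refl = subst (λ z → 0ℤ ≤ + 2 - z)
        (sym (cong₂ _+_ roots-0 (trans (cong roots (𝔽.zeroʳ ν)) roots-0))) (+≤+ z≤n)
      ... | inj₂ n | no _ = subst (λ z → 0ℤ ≤ + 2 - (z + roots (ν ⊗ t))) (sym (roots-nonsquare n))
        (subst (λ z → 0ℤ ≤ + 2 - z) (sym (+-identityˡ (roots (ν ⊗ t)))) (i≤j⇒0≤j-i (roots-≤2 (ν ⊗ t))))
      ... | inj₁ (y , refl) | no t≢0 = subst (λ z → 0ℤ ≤ + 2 - z)
        (sym (cong₂ _+_ (roots-square y≢0) (roots-nonsquare λ z → quotient-square {y} {z} y≢0)))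
        (+≤+ z≤n)
        where y≢0 = root-≢0 t≢0 refl

      total : ∑𝔽 (λ t → + 2 - (roots t + roots (ν ⊗ t))) ≡ 0ℤ
      total = trans
        (∑-cong elements λ t → solve 1 (λ x → con (+ 2) :- x := :- con 1ℤ :* x :+ con (+ 2)) refl (roots t + roots (ν ⊗ t)))
        (trans (∑-*+const elements (- 1ℤ) (λ t → roots t + roots (ν ⊗ t)) (+ 2))
          (trans (cong (λ z → - 1ℤ * z + q * + 2)
            (trans (∑-+ elements _ _) (cong₂ _+_ ∑-roots (trans (∑𝔽-scale ν≢0 roots) ∑-roots))))
            (solve 1 (λ q → :- con 1ℤ :* (q :+ q) :+ q :* con (+ 2) := con 0ℤ) refl q)))

    -- For fixed `x` the equation u² = (az)² + βx² factors as (u - az)(u + az) = βx², a hyperbola.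
    -- It has 2q - 1 points for x = 0 and q - 1 for each other x, and 2q - 1 + (q - 1)² = q².
    ternary-count-square : ∀ {a β} → a ≢ 0# → β ≢ 0# →
      ∑𝔽 (λ x → ∑𝔽 λ z → roots (a ⊗ a ⊗ (z ⊗ z) ⊕ β ⊗ (x ⊗ x))) ≡ q * q
    ternary-count-square {a} {β} a≢0 β≢0 = trans
        (∑-cong elements λ x → trans (row (β ⊗ (x ⊗ x)))
          (trans (cong (λ i → (q - 1ℤ) + q * i) (ι-cong (β ⊗ (x ⊗ x) ≟ 0#) (x ≟ 0#)
            (λ e → square-zero ([ (λ p → ⊥-elim (β≢0 p)) , (λ p → p) ]′ (zero-product e)))
            (λ e → trans (cong (λ x → β ⊗ (x ⊗ x)) e)
              (𝔽-solve 1 (λ b → b ⊠ (𝔽-con 0ℤ ⊠ 𝔽-con 0ℤ) ≋ 𝔽-con 0ℤ) refl β))))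
            (+-comm (q - 1ℤ) _)))
        (trans (∑-*+const elements q (λ x → ι (x ≟ 0#)) (q - 1ℤ))
          (trans (cong (λ i → q * i + q * (q - 1ℤ)) (∑-δ-count 0#))
            (solve 1 (λ q → q :* con 1ℤ :+ q :* (q :- con 1ℤ) := q :* q) refl q)))
      where
      factor : ∀ z u w → (u ⊕ a ⊗ z) ⊗ (u ⊕ a ⊗ z) ≡ (a ⊗ a) ⊗ (z ⊗ z) ⊕ w →
               u ⊗ ((a ⊕ a) ⊗ z ⊕ u) ≡ w
      factor z u w e = trans
        (𝔽-solve 3 (λ a z u → u ⊠ ((a ⊞ a) ⊠ z ⊞ u) ≋
          (u ⊞ a ⊠ z) ⊠ (u ⊞ a ⊠ z) ⊞ ⊟ ((a ⊠ a) ⊠ (z ⊠ z))) refl a z u)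
        (trans (cong (_⊕ ⊖ (a ⊗ a ⊗ (z ⊗ z))) e) (𝔽-solve 2 (λ s w → s ⊞ w ⊞ ⊟ s ≋ w) refl _ w))

      unfactor : ∀ z u w → u ⊗ ((a ⊕ a) ⊗ z ⊕ u) ≡ w →
                 (u ⊕ a ⊗ z) ⊗ (u ⊕ a ⊗ z) ≡ (a ⊗ a) ⊗ (z ⊗ z) ⊕ w
      unfactor z u w e = trans
        (𝔽-solve 3 (λ a z u → (u ⊞ a ⊠ z) ⊠ (u ⊞ a ⊠ z) ≋
          (a ⊠ a) ⊠ (z ⊠ z) ⊞ u ⊠ ((a ⊞ a) ⊠ z ⊞ u)) refl a z u)
        (cong (_ ⊕_) e)

      row : ∀ w → ∑𝔽 (λ z → roots ((a ⊗ a) ⊗ (z ⊗ z) ⊕ w)) ≡ (q - 1ℤ) + q * ι (w ≟ 0#)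
      row w = trans
        (∑-cong elements λ z → trans
          -- The shifted `u` stands for the factor u - az, so the other factor is 2az + u; for fixed
          -- `u` this runs through the field as `z` does.
          (sym (∑𝔽-translate (a ⊗ z) λ u → ι (u ⊗ u ≟ (a ⊗ a) ⊗ (z ⊗ z) ⊕ w)))
          (∑-cong elements λ u → ι-cong _ (u ⊗ ((a ⊕ a) ⊗ z ⊕ u) ≟ w) (factor z u w) (unfactor z u w)))
        (trans (∑-swap elements elements _) (trans
          (∑-cong elements λ u → trans
            (∑𝔽-scale (double-≢0 a≢0) λ z → ι (u ⊗ (z ⊕ u) ≟ w))
            (∑𝔽-translate u λ z → ι (u ⊗ z ≟ w)))
          (hyperbola-count w)))

    -- If α is not a square, multiplying the right-hand side by α makes the coefficient of z² the
    -- square α². The root counts of a value and of its α-multiple add up to 2, so the two totals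
    -- add up to 2q², and the second one is q².
    ternary-count : ∀ {α β} → α ≢ 0# → β ≢ 0# →
      ∑𝔽 (λ x → ∑𝔽 λ z → roots (α ⊗ (z ⊗ z) ⊕ β ⊗ (x ⊗ x))) ≡ q * q
    ternary-count {α} {β} α≢0 β≢0 with square? α
    ... | inj₁ (a , refl)  = ternary-count-square (root-≢0 α≢0 refl) β≢0
    ... | inj₂ nonsquare = trans
      (solve 2 (λ x y → x := (x :+ y) :- y) refl _ (q * q))
      (trans (cong (_- q * q) sum-with-multiple)
        (solve 1 (λ q → q :* (q :* con (+ 2)) :- q :* q := q :* q) refl q))
      where
      complementary : ∀ x z → roots (α ⊗ (z ⊗ z) ⊕ β ⊗ (x ⊗ x)) +
                      roots (α ⊗ α ⊗ (z ⊗ z) ⊕ α ⊗ β ⊗ (x ⊗ x)) ≡ + 2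
      complementary x z = trans
        (cong (λ t → roots (α ⊗ (z ⊗ z) ⊕ β ⊗ (x ⊗ x)) + roots t)
          (𝔽-solve 4 (λ α β x z → α ⊠ α ⊠ (z ⊠ z) ⊞ α ⊠ β ⊠ (x ⊠ x) ≋
            α ⊠ (α ⊠ (z ⊠ z) ⊞ β ⊠ (x ⊠ x))) refl α β x z))
        (roots-nonsquare-multiple nonsquare _)

      sum-with-multiple : ∑𝔽 (λ x → ∑𝔽 λ z → roots (α ⊗ (z ⊗ z) ⊕ β ⊗ (x ⊗ x))) + q * q ≡ q * (q * + 2)
      sum-with-multiple = trans
        (cong (_+_ (∑𝔽 (λ x → ∑𝔽 λ z → roots (α ⊗ (z ⊗ z) ⊕ β ⊗ (x ⊗ x)))))
          (sym (ternary-count-square α≢0 (⊗-≢0 α≢0 β≢0))))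
        (trans (sym (∑-+ elements (λ x → ∑𝔽 λ z → roots (α ⊗ (z ⊗ z) ⊕ β ⊗ (x ⊗ x))) _)) (trans
          (∑-cong elements λ x → trans (sym (∑-+ elements (λ z → roots (α ⊗ (z ⊗ z) ⊕ β ⊗ (x ⊗ x))) _))
            (trans (∑-cong elements λ z → complementary x z) (∑𝔽-const (+ 2))))
          (∑𝔽-const _)))

-- The form, its polar form, and point counts on hyperplanes and cones.

module QuadraticForms (F : FiniteField) where
  open import Data.List using (List; map; cartesianProduct)
  open import Data.Nat as ℕ using (ℕ; zero; suc)
  open import Data.Product using (_,_)
  open import Data.Sum using (_⊎_; inj₁; inj₂; [_,_]′)
  open import Data.Empty using (⊥-elim)
  open import Data.Vec using (Vec; []; _∷_; zipWith; replicate) renaming (map to mapᵥ)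
  open import Relation.Nullary using (yes; no)
  open import Relation.Binary.PropositionalEquality
  open OpaqueIntegers
  open IntegerSums
  open FieldCounting F public

  ∑-rotate : ∀ {A B C : Set} (xs : List A) (ys : List B) (zs : List C) (f : A → B → C → ℤ) →
    ∑ xs (λ x → ∑ ys λ y → ∑ zs λ z → f x y z) ≡ ∑ zs (λ z → ∑ xs λ x → ∑ ys λ y → f x y z)
  ∑-rotate xs ys zs f = trans (∑-cong xs λ x → ∑-swap ys zs (f x)) (∑-swap xs zs _)

  points : ∀ k → List (Point F k)
  points zero    = map (_∷ []) elements
  points (suc k) = map (λ { (a , b , v) → a ∷ b ∷ v })
    (cartesianProduct elements (cartesianProduct elements (points k)))

  ∑-points-zero : ∀ f → ∑ (points zero) f ≡ ∑𝔽 (λ x → f (x ∷ []))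
  ∑-points-zero = ∑-map (_∷ []) elements

  ∑-points-suc : ∀ k f → ∑ (points (suc k)) f ≡ ∑𝔽 (λ a → ∑𝔽 λ b → ∑ (points k) λ v → f (a ∷ b ∷ v))
  ∑-points-suc k f = trans (∑-map _ (cartesianProduct elements _) f)
    (trans (∑-cartesianProduct elements _ _) (∑-cong elements λ a → ∑-cartesianProduct elements (points k) _))

  pow : ℕ → ℤ
  pow zero    = 1ℤ
  pow (suc k) = q * pow k

  -- The number q^(2k+1) of points of the space, expressed through `pow k` so that the ring solver
  -- can compare it with p².
  volume : ℕ → ℤ
  volume k = q * (pow k * pow k)

  ∑-points-const : ∀ k c → ∑ (points k) (λ _ → c) ≡ volume k * c
  ∑-points-const zero    c = trans (∑-points-zero _) (trans (∑𝔽-const c)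
    (solve 2 (λ q c → q :* c := q :* (con 1ℤ :* con 1ℤ) :* c) refl q c))
  ∑-points-const (suc k) c = trans (∑-points-suc k _) (trans
    (∑-cong elements λ a → trans (∑-cong elements λ b → ∑-points-const k c) (∑𝔽-const _))
    (trans (∑𝔽-const _)
      (solve 3 (λ q p c → q :* (q :* (q :* (p :* p) :* c)) := q :* (q :* p :* (q :* p)) :* c) refl q (pow k) c)))

  ∑-points-linear : ∀ k b f c → ∑ (points k) (λ v → b * f v + c) ≡ b * ∑ (points k) f + volume k * c
  ∑-points-linear k b f c = trans (∑-+ (points k) _ _)
    (cong₂ _+_ (∑-*ˡ (points k) b f) (∑-points-const k c))

  infixl 6 _+ᵥ_
  infixl 7 _·ᵥ_

  _+ᵥ_ : ∀ {n} → Vec Carrier n → Vec Carrier n → Vec Carrier n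
  _+ᵥ_ = zipWith _⊕_

  _·ᵥ_ : ∀ {n} → Carrier → Vec Carrier n → Vec Carrier n
  z ·ᵥ w = mapᵥ (z ⊗_) w

  0ᵥ : ∀ {n} → Vec Carrier n
  0ᵥ = replicate _ 0#

  ∑-points-translate : ∀ k w f → ∑ (points k) (λ v → f (v +ᵥ w)) ≡ ∑ (points k) f
  ∑-points-translate zero (w ∷ []) f = trans (∑-points-zero _)
    (trans (∑𝔽-translate w λ x → f (x ∷ [])) (sym (∑-points-zero f)))
  ∑-points-translate (suc k) (α ∷ β ∷ w) f = trans (∑-points-suc k _) (trans
    (∑-cong elements λ a → trans
      (∑-cong elements λ b → ∑-points-translate k w λ v → f (a ⊕ α ∷ b ⊕ β ∷ v))
      (∑𝔽-translate β λ b → ∑ (points k) λ v → f (a ⊕ α ∷ b ∷ v)))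
    (trans (∑𝔽-translate α λ a → ∑𝔽 λ b → ∑ (points k) λ v → f (a ∷ b ∷ v)) (sym (∑-points-suc k f))))

  swap : ∀ {k} → Point F (suc k) → Point F (suc k)
  swap (a ∷ b ∷ v) = b ∷ a ∷ v

  ∑-points-swap : ∀ k f → ∑ (points (suc k)) (λ v → f (swap v)) ≡ ∑ (points (suc k)) f
  ∑-points-swap k f = trans (∑-points-suc k _) (trans (∑-swap elements elements _) (sym (∑-points-suc k f)))

  -- Rewriting one equation into another thereby costs a single ring identity between the
  -- differences of their sides; the scaled version below also allows a nonzero factor.
  ι-difference : ∀ {x y x′ y′} → x ⊕ ⊖ y ≡ x′ ⊕ ⊖ y′ → ι (x ≟ y) ≡ ι (x′ ≟ y′)
  ι-difference {x} {y} {x′} {y′} e = ι-cong (x ≟ y) (x′ ≟ y′) (go e) (go (sym e))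
    where
    go : ∀ {x y x′ y′} → x ⊕ ⊖ y ≡ x′ ⊕ ⊖ y′ → x ≡ y → x′ ≡ y′
    go {x} e refl = difference-zero (trans (sym e) (𝔽.-‿inverseʳ x))

  ι-difference-scaled : ∀ {c x y x′ y′} → c ≢ 0# → c ⊗ (x ⊕ ⊖ y) ≡ x′ ⊕ ⊖ y′ → ι (x ≟ y) ≡ ι (x′ ≟ y′)
  ι-difference-scaled {c} {x} {y} {x′} {y′} c≢0 e = trans
    (ι-cong (x ≟ y) (c ⊗ x ≟ c ⊗ y) (cong (c ⊗_)) (⊗-cancelˡ c≢0))
    (ι-difference (trans (𝔽-solve 3 (λ c x y → c ⊠ x ⊞ ⊟ (c ⊠ y) ≋ c ⊠ (x ⊞ ⊟ y)) refl c x y) e))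

  module Form (c : Carrier) where

    Qf : ∀ {k} → Point F k → Carrier
    Qf {k} = Qc F k c

    B : ∀ {k} → Point F k → Point F k → Carrier
    B {zero}  (x ∷ [])     (y ∷ [])     = ⊖ (c ⊗ (x ⊗ y ⊕ x ⊗ y))
    B {suc k} (a ∷ b ∷ v) (α ∷ β ∷ w) = (a ⊗ β ⊕ b ⊗ α) ⊕ B {k} v w

    Q-+ᵥ : ∀ {k} (v w : Point F k) z → Qf {k} (v +ᵥ (z ·ᵥ w)) ≡ Qf {k} v ⊕ z ⊗ B {k} v w ⊕ z ⊗ z ⊗ Qf {k} w
    Q-+ᵥ {zero} (x ∷ []) (y ∷ []) z = 𝔽-solve 4 (λ c x y z →
      ⊟ (c ⊠ ((x ⊞ z ⊠ y) ⊠ (x ⊞ z ⊠ y))) ≋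
      ⊟ (c ⊠ (x ⊠ x)) ⊞ z ⊠ ⊟ (c ⊠ (x ⊠ y ⊞ x ⊠ y)) ⊞ z ⊠ z ⊠ ⊟ (c ⊠ (y ⊠ y))) refl c x y z
    Q-+ᵥ {suc k} (a ∷ b ∷ v) (α ∷ β ∷ w) z = trans
      (cong ((a ⊕ z ⊗ α) ⊗ (b ⊕ z ⊗ β) ⊕_) (Q-+ᵥ {k} v w z))
      (𝔽-solve 8 (λ a b α β z Qv Bvw Qw →
        (a ⊞ z ⊠ α) ⊠ (b ⊞ z ⊠ β) ⊞ (Qv ⊞ z ⊠ Bvw ⊞ z ⊠ z ⊠ Qw) ≋
        (a ⊠ b ⊞ Qv) ⊞ z ⊠ ((a ⊠ β ⊞ b ⊠ α) ⊞ Bvw) ⊞ z ⊠ z ⊠ (α ⊠ β ⊞ Qw)) refl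
        a b α β z (Qf {k} v) (B {k} v w) (Qf {k} w))

    B-vsub : ∀ {k} (v x y : Point F k) → B {k} v (vsub F {k} x y) ≡ B {k} v x ⊕ ⊖ B {k} v y
    B-vsub {zero} (v ∷ []) (x ∷ []) (y ∷ []) = 𝔽-solve 4 (λ c v x y →
      ⊟ (c ⊠ (v ⊠ (x ⊞ ⊟ y) ⊞ v ⊠ (x ⊞ ⊟ y))) ≋
      ⊟ (c ⊠ (v ⊠ x ⊞ v ⊠ x)) ⊞ ⊟ ⊟ (c ⊠ (v ⊠ y ⊞ v ⊠ y))) refl c v x y
    B-vsub {suc k} (a ∷ b ∷ v) (x ∷ x′ ∷ xs) (y ∷ y′ ∷ ys) = trans
      (cong (_⊕_ _) (B-vsub {k} v xs ys))
      (𝔽-solve 8 (λ a b x x′ y y′ s t →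
        (a ⊠ (x′ ⊞ ⊟ y′) ⊞ b ⊠ (x ⊞ ⊟ y)) ⊞ (s ⊞ ⊟ t) ≋
        ((a ⊠ x′ ⊞ b ⊠ x) ⊞ s) ⊞ ⊟ ((a ⊠ y′ ⊞ b ⊠ y) ⊞ t)) refl
        a b x x′ y y′ (B {k} v xs) (B {k} v ys))

    B-0ᵥ : ∀ {k} (v : Point F k) → B {k} v 0ᵥ ≡ 0#
    B-0ᵥ {zero} (x ∷ []) = 𝔽-solve 2 (λ c x →
      ⊟ (c ⊠ (x ⊠ 𝔽-con 0ℤ ⊞ x ⊠ 𝔽-con 0ℤ)) ≋ 𝔽-con 0ℤ) refl c x
    B-0ᵥ {suc k} (a ∷ b ∷ v) = trans (cong (_⊕_ _) (B-0ᵥ {k} v))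
      (𝔽-solve 2 (λ a b → (a ⊠ 𝔽-con 0ℤ ⊞ b ⊠ 𝔽-con 0ℤ) ⊞ 𝔽-con 0ℤ ≋ 𝔽-con 0ℤ) refl a b)

    B-null-head : ∀ {k} a b (v w : Point F k) → B {suc k} (a ∷ b ∷ v) (0# ∷ 0# ∷ w) ≡ B {k} v w
    B-null-head {k} a b v w = 𝔽-solve 3 (λ a b s →
      (a ⊠ 𝔽-con 0ℤ ⊞ b ⊠ 𝔽-con 0ℤ) ⊞ s ≋ s) refl a b (B {k} v w)

    B-swap : ∀ {k} (v w : Point F (suc k)) → B {suc k} (swap {k} v) (swap {k} w) ≡ B {suc k} v w
    B-swap {k} (a ∷ b ∷ v) (α ∷ β ∷ w) = cong (_⊕ B {k} v w) (𝔽.+-comm (b ⊗ α) (a ⊗ β))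

    Q-swap : ∀ {k} (v : Point F (suc k)) → Qf {suc k} (swap {k} v) ≡ Qf {suc k} v
    Q-swap {k} (a ∷ b ∷ v) = cong (_⊕ Qf {k} v) (𝔽.*-comm b a)

    module Nondegenerate (c≢0 : c ≢ 0#) (2≢0 : 1# ⊕ 1# ≢ 0#) where
      open OddCharacteristic 2≢0 public

      -- As `α` is invertible, `a` and `v` can be chosen freely and then determine `b`.
      hyperplane-count-suc : ∀ k {α} → α ≢ 0# → ∀ β (w : Point F k) s →
        ∑ (points (suc k)) (λ v → ι (B {suc k} v (α ∷ β ∷ w) ≟ s)) ≡ pow (suc k) * pow (suc k)
      hyperplane-count-suc k {α} α≢0 β w s = trans (∑-points-suc k _) (trans
        (∑-cong elements λ a → trans (∑-swap elements (points k) _)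
          (trans (∑-cong (points k) λ v → trans
            (∑-cong elements λ b → ι-difference (isolate a b (B {k} v w)))
            (∑𝔽-linear α≢0 (s ⊕ ⊖ (a ⊗ β) ⊕ ⊖ B {k} v w)))
          (∑-points-const k 1ℤ)))
        (trans (∑𝔽-const _)
          (solve 2 (λ q p → q :* (q :* (p :* p) :* con 1ℤ) := (q :* p) :* (q :* p)) refl q (pow k))))
        where
        isolate : ∀ a b t → ((a ⊗ β ⊕ b ⊗ α) ⊕ t) ⊕ ⊖ s ≡ α ⊗ b ⊕ ⊖ (s ⊕ ⊖ (a ⊗ β) ⊕ ⊖ t)
        isolate a b t = 𝔽-solve 6 (λ α β a b s t →
          ((a ⊠ β ⊞ b ⊠ α) ⊞ t) ⊞ ⊟ s ≋ α ⊠ b ⊞ ⊟ (s ⊞ ⊟ (a ⊠ β) ⊞ ⊟ t)) refl α β a b s t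

      -- Nondegeneracy of the polar form: a nonzero `w` has a nonzero coordinate, and the coordinate
      -- paired with it can be solved for. The search for it peels off hyperbolic pairs; in the last
      -- coordinate it uses that 2 and `c` are invertible.
      hyperplane-count : ∀ k (w : Point F k) →
        w ≡ 0ᵥ ⊎ (∀ s → ∑ (points k) (λ v → ι (B {k} v w ≟ s)) ≡ pow k * pow k)
      hyperplane-count zero (w ∷ []) with w ≟ 0#
      ... | yes refl = inj₁ refl
      ... | no w≢0   = inj₂ λ s → trans (∑-points-zero _) (trans
        (∑-cong elements λ x → cong (λ t → ι (t ≟ s)) (𝔽-solve 3 (λ c x w →
          ⊟ (c ⊠ (x ⊠ w ⊞ x ⊠ w)) ≋ ⊟ (c ⊠ (w ⊞ w)) ⊠ x) refl c x w))
        (trans (∑𝔽-linear (⊖-≢0 (⊗-≢0 c≢0 (double-≢0 w≢0))) s) (sym (*-identityˡ 1ℤ))))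
      hyperplane-count (suc k) (α ∷ β ∷ w) with α ≟ 0# | β ≟ 0#
      ... | no α≢0   | _        = inj₂ (hyperplane-count-suc k α≢0 β w)
      ... | yes refl | no β≢0   = inj₂ λ s → trans (sym (∑-points-swap k _)) (trans
        (∑-cong (points (suc k)) λ v → cong (λ t → ι (t ≟ s)) (B-swap {k} v (β ∷ 0# ∷ w)))
        (hyperplane-count-suc k β≢0 0# w s))
      ... | yes refl | yes refl with hyperplane-count k w
      ...   | inj₁ refl = inj₁ refl
      ...   | inj₂ h    = inj₂ λ s → trans (∑-points-suc k _) (trans
        (∑-cong elements λ a → trans (∑-cong elements λ b → trans
          (∑-cong (points k) λ v → cong (λ t → ι (t ≟ s)) (B-null-head {k} a b v w))
          (h s)) (∑𝔽-const _))
        (trans (∑𝔽-const _)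
          (solve 2 (λ q p → q :* (q :* (p :* p)) := (q :* p) :* (q :* p)) refl q (pow k))))

      -- The cone attached to the sphere of radius r, and its hyperplane sections.

      module Sphere (r : Carrier) (r≢0 : r ≢ 0#) where

        σ : ℤ
        σ = roots (⊖ (r ⊗ c)) - 1ℤ

        -rc≢0 : ⊖ (r ⊗ c) ≢ 0#
        -rc≢0 = ⊖-≢0 (⊗-≢0 r≢0 c≢0)

        σ-square : σ * σ ≡ 1ℤ
        σ-square with square? (⊖ (r ⊗ c))
        ... | inj₁ (y , e) = trans (cong (λ z → (z - 1ℤ) * (z - 1ℤ))
          (trans (cong roots (sym e)) (roots-square (root-≢0 -rc≢0 e)))) (*-identityˡ 1ℤ)
        ... | inj₂ n = trans (cong (λ z → (z - 1ℤ) * (z - 1ℤ)) (roots-nonsquare n))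
          (solve 0 (:- con 1ℤ :* :- con 1ℤ := con 1ℤ) refl)

        -- The constant `h` allows one recursion to serve both the cone itself, with `h` zero, and
        -- its diagonalised sections, where `h` carries the square of one more variable.
        coneCount : ∀ k → Carrier → ℤ
        coneCount k h = ∑ (points k) λ v → roots (r ⊗ (h ⊕ Qf {k} v))

        -- Division by `r` gives ab = u²/r - h - s, a hyperbola that degenerates exactly when u² =
        -- r(h + s).
        hyperbola-fibre : ∀ u h s → ∑𝔽 (λ a → ∑𝔽 λ b → ι (u ⊗ u ≟ r ⊗ (h ⊕ (a ⊗ b ⊕ s)))) ≡
                          (q - 1ℤ) + q * ι (u ⊗ u ≟ r ⊗ (h ⊕ s))
        hyperbola-fibre u h s with inverse r r≢0
        ... | r⁻¹ , rr⁻¹ = trans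
          (∑-cong elements λ a → ∑-cong elements λ b → sym (ι-difference-scaled (⊖-≢0 r≢0) (trans
            (𝔽-solve 7 (λ r i u h s a b →
              ⊟ r ⊠ (a ⊠ b ⊞ ⊟ (i ⊠ (u ⊠ u) ⊞ ⊟ (h ⊞ s))) ≋
              (r ⊠ i) ⊠ (u ⊠ u) ⊞ ⊟ (r ⊠ (h ⊞ (a ⊠ b ⊞ s)))) refl r r⁻¹ u h s a b)
            (trans (cong (λ i → i ⊗ (u ⊗ u) ⊕ ⊖ (r ⊗ (h ⊕ (a ⊗ b ⊕ s)))) rr⁻¹)
              (cong (_⊕ ⊖ (r ⊗ (h ⊕ (a ⊗ b ⊕ s)))) (𝔽.*-identityˡ _))))))
          (trans (hyperbola-count (r⁻¹ ⊗ (u ⊗ u) ⊕ ⊖ (h ⊕ s)))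
            (cong (λ i → (q - 1ℤ) + q * i) (ι-difference-scaled r≢0 (trans
              (𝔽-solve 5 (λ r i u h s → r ⊠ ((i ⊠ (u ⊠ u) ⊞ ⊟ (h ⊞ s)) ⊞ ⊟ 𝔽-con 0ℤ) ≋
                (r ⊠ i) ⊠ (u ⊠ u) ⊞ ⊟ (r ⊠ (h ⊞ s))) refl r r⁻¹ u h s)
              (trans (cong (λ i → i ⊗ (u ⊗ u) ⊕ ⊖ (r ⊗ (h ⊕ s))) rr⁻¹)
                (cong (_⊕ ⊖ (r ⊗ (h ⊕ s))) (𝔽.*-identityˡ _)))))))

        coneCount-suc : ∀ k h → coneCount (suc k) h ≡ (q - 1ℤ) * (volume k * q) + q * coneCount k h
        coneCount-suc k h = trans (∑-points-suc k _) (trans (∑-rotate elements elements (points k) _) (trans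
          (∑-cong (points k) λ v → trans (∑-rotate elements elements elements _)
            (trans (∑-cong elements λ u → trans (hyperbola-fibre u h (Qf {k} v)) (+-comm (q - 1ℤ) _))
              (∑-*+const elements q (λ u → ι (u ⊗ u ≟ r ⊗ (h ⊕ Qf {k} v))) (q - 1ℤ))))
          (trans (∑-points-linear k q _ (q * (q - 1ℤ)))
            (solve 3 (λ q V N → q :* N :+ V :* (q :* (q :- con 1ℤ)) := (q :- con 1ℤ) :* (V :* q) :+ q :* N)
              refl q (volume k) (coneCount k h)))))

        -- Each hyperbolic plane multiplies the deviation from `volume k` by q, so the whole
        -- deviation stems from the last coordinate, where the expected count is q.
        coneCount-line : ∀ k h → coneCount k h ≡ volume k + pow k * (coneCount 0 h - q)
        coneCount-line zero    h = solve 2 (λ q N → N := q :* (con 1ℤ :* con 1ℤ) :+ con 1ℤ :* (N :- q)) refl q (coneCount 0 h)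
        coneCount-line (suc k) h = trans (coneCount-suc k h) (trans
          (cong (λ N → (q - 1ℤ) * (volume k * q) + q * N) (coneCount-line k h))
          (solve 3 (λ q p N → (q :- con 1ℤ) :* (q :* (p :* p) :* q) :+ q :* (q :* (p :* p) :+ p :* (N :- q)) :=
            q :* ((q :* p) :* (q :* p)) :+ q :* p :* (N :- q)) refl q (pow k) (coneCount 0 h)))

        -- In dimension one the equation is u² = -rcx²: one root for x = 0 and σ + 1 roots for each
        -- other x, hence q + σ(q - 1) in all.
        coneCount-0 : ∀ k → coneCount k 0# ≡ volume k + pow k * (σ * (q - 1ℤ))
        coneCount-0 k = trans (coneCount-line k 0#) (cong (λ z → volume k + pow k * z) (trans
          (cong (_- q) (trans (∑-points-zero _) (trans (∑-cong elements term)
            (trans (∑-*+const elements (- σ) (λ x → ι (x ≟ 0#)) (σ + 1ℤ))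
              (cong (λ z → - σ * z + q * (σ + 1ℤ)) (∑-δ-count 0#))))))
          (solve 2 (λ q σ → (:- σ :* con 1ℤ :+ q :* (σ :+ con 1ℤ)) :- q := σ :* (q :- con 1ℤ)) refl q σ)))
          where
          term : ∀ x → roots (r ⊗ (0# ⊕ ⊖ (c ⊗ (x ⊗ x)))) ≡ - σ * ι (x ≟ 0#) + (σ + 1ℤ)
          term x with x ≟ 0#
          ... | yes refl = trans (cong roots (𝔽-solve 2 (λ r c →
              r ⊠ (𝔽-con 0ℤ ⊞ ⊟ (c ⊠ (𝔽-con 0ℤ ⊠ 𝔽-con 0ℤ))) ≋ 𝔽-con 0ℤ) refl r c))
            (trans roots-0 (solve 1 (λ σ → con 1ℤ := :- σ :* con 1ℤ :+ (σ :+ con 1ℤ)) refl σ))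
          ... | no x≢0 = trans (cong roots (𝔽-solve 3 (λ r c x →
              r ⊠ (𝔽-con 0ℤ ⊞ ⊟ (c ⊠ (x ⊠ x))) ≋ x ⊠ x ⊠ ⊟ (r ⊠ c)) refl r c x))
            (trans (roots-scale x≢0 _)
              (solve 2 (λ s σ → s := :- σ :* con 0ℤ :+ ((s :- con 1ℤ) :+ con 1ℤ)) refl (roots (⊖ (r ⊗ c))) σ))

        -- With z as a variable the one-dimensional count becomes that of a nondegenerate ternary
        -- quadric, which has exactly q² points; the deviation in `coneCount-line` thus cancels over
        -- z.
        ∑-coneCount-quadratic : ∀ k {τ} → τ ≢ 0# → ∑𝔽 (λ z → coneCount k (τ ⊗ (z ⊗ z))) ≡ q * volume k
        ∑-coneCount-quadratic k {τ} τ≢0 = trans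
          (∑-cong elements λ z → trans (coneCount-line k _)
            (solve 4 (λ V p N q → V :+ p :* (N :- q) := p :* N :+ (V :- p :* q)) refl (volume k) (pow k) _ q))
          (trans (∑-*+const elements (pow k) (λ z → coneCount 0 (τ ⊗ (z ⊗ z))) _)
            (trans (cong (λ N → pow k * N + q * (volume k - pow k * q)) ternary)
              (solve 3 (λ q p V → p :* (q :* q) :+ q :* (V :- p :* q) := q :* V) refl q (pow k) (volume k))))
          where
          ternary : ∑𝔽 (λ z → coneCount 0 (τ ⊗ (z ⊗ z))) ≡ q * q
          ternary = trans (∑-cong elements λ z → ∑-points-zero _) (trans (∑-swap elements elements _) (trans
            (∑-cong elements λ x → ∑-cong elements λ z → cong roots (𝔽-solve 5 (λ r c τ x z →
              r ⊠ (τ ⊠ (z ⊠ z) ⊞ ⊟ (c ⊠ (x ⊠ x))) ≋ r ⊠ τ ⊠ (z ⊠ z) ⊞ ⊟ (r ⊠ c) ⊠ (x ⊠ x)) refl r c τ x z))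
            (ternary-count (⊗-≢0 r≢0 τ≢0) -rc≢0)))

        sectionCount : ∀ k → Point F k → ℤ
        sectionCount k w = ∑ (points k) λ v → ∑𝔽 λ u →
          ι (u ⊗ u ≟ r ⊗ Qf {k} v) * ι (B {k} v w ≟ u ⊕ u)

        -- Solving the linear equation for the second coordinate and completing squares, in v along w
        -- and in u, diagonalises the section.
        sectionCount-diagonal : ∀ k {α} → α ≢ 0# → ∀ β (w : Point F k) →
          sectionCount (suc k) (α ∷ β ∷ w) ≡
          ∑𝔽 (λ z → coneCount k ((r ⊕ ⊖ Qf {suc k} (α ∷ β ∷ w)) ⊗ (z ⊗ z)))
        sectionCount-diagonal k {α} α≢0 β w with inverse α α≢0
        ... | α⁻¹ , αα⁻¹ = trans (∑-points-suc k _) (trans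
          (∑-cong elements λ a → trans (∑-rotate′ a) (∑-cong (points k) λ v → ∑-cong elements λ u → eliminate a v u))
          -- With a = αz the equation reads u² = 2rzu + r(Q(v - zw) - tz²). Shifting v by zw and u
          -- by rz leaves u² = r((r - t)z² + Q(v)).
          (trans (sym (∑𝔽-scale α≢0 _)) (∑-cong elements λ z → trans
            (∑-cong (points k) λ v → ∑-cong elements λ u → cong (λ t → ι (u ⊗ u ≟ t)) (substituted z v u))
            (trans (∑-points-translate k (⊖ z ·ᵥ w) λ v → ∑𝔽 λ u → ι (u ⊗ u ≟ r ⊗ z ⊗ (u ⊕ u) ⊕ r ⊗ (Qf {k} v ⊕ ⊖ (t ⊗ (z ⊗ z)))))
              (∑-cong (points k) λ v → trans
                (sym (∑𝔽-translate (r ⊗ z) λ u → ι (u ⊗ u ≟ r ⊗ z ⊗ (u ⊕ u) ⊕ r ⊗ (Qf {k} v ⊕ ⊖ (t ⊗ (z ⊗ z))))))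
                (∑-cong elements λ u → ι-difference (complete-square u z (Qf {k} v))))))))
          where
          t : Carrier
          t = Qf {suc k} (α ∷ β ∷ w)

          solution : Carrier → Point F k → Carrier → Carrier
          solution a v u = α⁻¹ ⊗ ((u ⊕ u) ⊕ ⊖ (a ⊗ β) ⊕ ⊖ B {k} v w)

          ∑-rotate′ : ∀ a →
            ∑𝔽 (λ b → ∑ (points k) λ v → ∑𝔽 λ u → ι (u ⊗ u ≟ r ⊗ (a ⊗ b ⊕ Qf {k} v)) * ι ((a ⊗ β ⊕ b ⊗ α) ⊕ B {k} v w ≟ u ⊕ u)) ≡
            ∑ (points k) (λ v → ∑𝔽 λ u → ∑𝔽 λ b → ι (u ⊗ u ≟ r ⊗ (a ⊗ b ⊕ Qf {k} v)) * ι ((a ⊗ β ⊕ b ⊗ α) ⊕ B {k} v w ≟ u ⊕ u))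
          ∑-rotate′ a = trans (∑-swap elements (points k) _) (∑-cong (points k) λ v → ∑-swap elements elements _)

          eliminate : ∀ a v u →
            ∑𝔽 (λ b → ι (u ⊗ u ≟ r ⊗ (a ⊗ b ⊕ Qf {k} v)) * ι ((a ⊗ β ⊕ b ⊗ α) ⊕ B {k} v w ≟ u ⊕ u)) ≡
            ι (u ⊗ u ≟ r ⊗ (a ⊗ solution a v u ⊕ Qf {k} v))
          eliminate a v u = trans
            (∑-cong elements λ b → trans (*-comm _ _) (cong (_* ι (u ⊗ u ≟ r ⊗ (a ⊗ b ⊕ Qf {k} v)))
              (sym (ι-difference-scaled α≢0 (linear b)))))
            (∑-δ (solution a v u) λ b → ι (u ⊗ u ≟ r ⊗ (a ⊗ b ⊕ Qf {k} v)))
            where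
            linear : ∀ b → α ⊗ (b ⊕ ⊖ solution a v u) ≡ ((a ⊗ β ⊕ b ⊗ α) ⊕ B {k} v w) ⊕ ⊖ (u ⊕ u)
            linear b = trans
              (𝔽-solve 7 (λ α i β a b u s →
                α ⊠ (b ⊞ ⊟ (i ⊠ ((u ⊞ u) ⊞ ⊟ (a ⊠ β) ⊞ ⊟ s))) ≋
                α ⊠ b ⊞ ⊟ ((α ⊠ i) ⊠ ((u ⊞ u) ⊞ ⊟ (a ⊠ β) ⊞ ⊟ s))) refl α α⁻¹ β a b u (B {k} v w))
              (trans (cong (λ i → α ⊗ b ⊕ ⊖ (i ⊗ ((u ⊕ u) ⊕ ⊖ (a ⊗ β) ⊕ ⊖ B {k} v w))) αα⁻¹)
                (𝔽-solve 6 (λ α β a b u s →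
                  α ⊠ b ⊞ ⊟ (𝔽-con 1ℤ ⊠ ((u ⊞ u) ⊞ ⊟ (a ⊠ β) ⊞ ⊟ s)) ≋
                  ((a ⊠ β ⊞ b ⊠ α) ⊞ s) ⊞ ⊟ (u ⊞ u)) refl α β a b u (B {k} v w)))

          substituted : ∀ z v u → r ⊗ ((α ⊗ z) ⊗ solution (α ⊗ z) v u ⊕ Qf {k} v) ≡
                        r ⊗ z ⊗ (u ⊕ u) ⊕ r ⊗ (Qf {k} (v +ᵥ (⊖ z ·ᵥ w)) ⊕ ⊖ (t ⊗ (z ⊗ z)))
          substituted z v u = trans
            (𝔽-solve 8 (λ r α i β z u s Qv →
              r ⊠ ((α ⊠ z) ⊠ (i ⊠ ((u ⊞ u) ⊞ ⊟ ((α ⊠ z) ⊠ β) ⊞ ⊟ s)) ⊞ Qv) ≋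
              r ⊠ ((α ⊠ i) ⊠ (z ⊠ ((u ⊞ u) ⊞ ⊟ ((α ⊠ z) ⊠ β) ⊞ ⊟ s)) ⊞ Qv)) refl
              r α α⁻¹ β z u (B {k} v w) (Qf {k} v))
            (trans (cong (λ i → r ⊗ (i ⊗ (z ⊗ ((u ⊕ u) ⊕ ⊖ ((α ⊗ z) ⊗ β) ⊕ ⊖ B {k} v w)) ⊕ Qf {k} v)) αα⁻¹)
              (trans
                (𝔽-solve 8 (λ r α β z u s Qv Qw →
                  r ⊠ (𝔽-con 1ℤ ⊠ (z ⊠ ((u ⊞ u) ⊞ ⊟ ((α ⊠ z) ⊠ β) ⊞ ⊟ s)) ⊞ Qv) ≋
                  r ⊠ z ⊠ (u ⊞ u) ⊞ r ⊠ ((Qv ⊞ ⊟ z ⊠ s ⊞ ⊟ z ⊠ ⊟ z ⊠ Qw) ⊞ ⊟ ((α ⊠ β ⊞ Qw) ⊠ (z ⊠ z)))) refl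
                  r α β z u (B {k} v w) (Qf {k} v) (Qf {k} w))
                (cong (λ y → r ⊗ z ⊗ (u ⊕ u) ⊕ r ⊗ (y ⊕ ⊖ (t ⊗ (z ⊗ z)))) (sym (Q-+ᵥ {k} v w (⊖ z))))))

          complete-square : ∀ u z y →
            (u ⊕ r ⊗ z) ⊗ (u ⊕ r ⊗ z) ⊕ ⊖ (r ⊗ z ⊗ ((u ⊕ r ⊗ z) ⊕ (u ⊕ r ⊗ z)) ⊕ r ⊗ (y ⊕ ⊖ (t ⊗ (z ⊗ z)))) ≡
            u ⊗ u ⊕ ⊖ (r ⊗ ((r ⊕ ⊖ t) ⊗ (z ⊗ z) ⊕ y))
          complete-square u z y = 𝔽-solve 5 (λ r t u z y →
            (u ⊞ r ⊠ z) ⊠ (u ⊞ r ⊠ z) ⊞ ⊟ (r ⊠ z ⊠ ((u ⊞ r ⊠ z) ⊞ (u ⊞ r ⊠ z)) ⊞ r ⊠ (y ⊞ ⊟ (t ⊠ (z ⊠ z)))) ≋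
            u ⊠ u ⊞ ⊟ (r ⊠ ((r ⊞ ⊟ t) ⊠ (z ⊠ z) ⊞ y))) refl r t u z y

        SectionFormula : ∀ k → Point F k → Set
        SectionFormula k w = sectionCount k w ≡ pow k * pow k + σ * (q - 1ℤ) * pow k * ι (Qf {k} w ≟ r)

        -- After diagonalisation z² has coefficient r - t inside the cone equation. For t ≠ r the
        -- total is exactly the expected one. For t = r the variable z drops out, and each of its q
        -- values contributes a full cone with its deviation σ(q - 1)p.
        section-formula-suc : ∀ k {α} → α ≢ 0# → ∀ β (w : Point F k) → SectionFormula (suc k) (α ∷ β ∷ w)
        section-formula-suc k {α} α≢0 β w = trans (sectionCount-diagonal k α≢0 β w) diagonal
          where
          t : Carrier
          t = Qf {suc k} (α ∷ β ∷ w)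

          diagonal : ∑𝔽 (λ z → coneCount k ((r ⊕ ⊖ t) ⊗ (z ⊗ z))) ≡
                     pow (suc k) * pow (suc k) + σ * (q - 1ℤ) * pow (suc k) * ι (t ≟ r)
          diagonal with t ≟ r
          ... | no t≢r = trans (∑-coneCount-quadratic k λ e → t≢r (sym (difference-zero e)))
            (solve 3 (λ q p s → q :* (q :* (p :* p)) := (q :* p) :* (q :* p) :+ s :* (q :- con 1ℤ) :* (q :* p) :* con 0ℤ)
              refl q (pow k) σ)
          ... | yes t≡r = trans
            (∑-cong elements λ z → trans (cong (λ s → coneCount k ((r ⊕ ⊖ s) ⊗ (z ⊗ z))) t≡r)
              (trans (cong (coneCount k) (𝔽-solve 2 (λ r z → (r ⊞ ⊟ r) ⊠ (z ⊠ z) ≋ 𝔽-con 0ℤ) refl r z))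
                (coneCount-0 k)))
            (trans (∑𝔽-const _)
              (solve 3 (λ q p s → q :* (q :* (p :* p) :+ p :* (s :* (q :- con 1ℤ))) :=
                (q :* p) :* (q :* p) :+ s :* (q :- con 1ℤ) :* (q :* p) :* con 1ℤ) refl q (pow k) σ))

        -- A nonzero entry in the first hyperbolic pair of `w` allows direct diagonalisation, after
        -- a swap if necessary. If both entries vanish, the pair is summed out and the dimension
        -- drops. In dimension one the linear equation forces u = -cxw.
        section-formula : ∀ k (w : Point F k) → SectionFormula k w
        section-formula zero (w ∷ []) = trans (∑-points-zero _) (trans (∑-cong elements fibre) total)
          where
          fibre : ∀ x → ∑𝔽 (λ u → ι (u ⊗ u ≟ r ⊗ ⊖ (c ⊗ (x ⊗ x))) * ι (⊖ (c ⊗ (x ⊗ w ⊕ x ⊗ w)) ≟ u ⊕ u)) ≡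
                        ι (c ⊗ (x ⊗ x) ⊗ (r ⊕ ⊖ ⊖ (c ⊗ (w ⊗ w))) ≟ 0#)
          fibre x = trans
            (∑-cong elements λ u → trans (*-comm _ _) (cong (_* ι (u ⊗ u ≟ r ⊗ ⊖ (c ⊗ (x ⊗ x))))
              (sym (ι-difference-scaled (⊖-≢0 2≢0)
                (𝔽-solve 4 (λ c x w u → ⊟ (𝔽-con 1ℤ ⊞ 𝔽-con 1ℤ) ⊠ (u ⊞ ⊟ ⊟ (c ⊠ (x ⊠ w))) ≋
                  ⊟ (c ⊠ (x ⊠ w ⊞ x ⊠ w)) ⊞ ⊟ (u ⊞ u)) refl c x w u)))))
            (trans (∑-δ (⊖ (c ⊗ (x ⊗ w))) λ u → ι (u ⊗ u ≟ r ⊗ ⊖ (c ⊗ (x ⊗ x))))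
              (ι-difference (𝔽-solve 4 (λ r c x w →
                ⊟ (c ⊠ (x ⊠ w)) ⊠ ⊟ (c ⊠ (x ⊠ w)) ⊞ ⊟ (r ⊠ ⊟ (c ⊠ (x ⊠ x))) ≋
                c ⊠ (x ⊠ x) ⊠ (r ⊞ ⊟ ⊟ (c ⊠ (w ⊠ w))) ⊞ ⊟ 𝔽-con 0ℤ) refl r c x w)))

          total : ∑𝔽 (λ x → ι (c ⊗ (x ⊗ x) ⊗ (r ⊕ ⊖ ⊖ (c ⊗ (w ⊗ w))) ≟ 0#)) ≡
                  1ℤ * 1ℤ + σ * (q - 1ℤ) * 1ℤ * ι (⊖ (c ⊗ (w ⊗ w)) ≟ r)
          total with ⊖ (c ⊗ (w ⊗ w)) ≟ r
          ... | no t≢r = trans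
            (∑𝔽-unique _ 0# (𝔽-solve 2 (λ c s → c ⊠ (𝔽-con 0ℤ ⊠ 𝔽-con 0ℤ) ⊠ s ≋ 𝔽-con 0ℤ) refl c _)
              λ x e → [ (λ p → square-zero ([ (λ c≡0 → ⊥-elim (c≢0 c≡0)) , (λ p → p) ]′ (zero-product p)))
                      , (λ p → ⊥-elim (t≢r (sym (difference-zero p)))) ]′ (zero-product e))
            (solve 2 (λ q s → con 1ℤ := con 1ℤ :* con 1ℤ :+ s :* (q :- con 1ℤ) :* con 1ℤ :* con 0ℤ) refl q σ)
          -- Every x is a solution here, which gives q. This agrees with 1 + σ(q - 1), as -cw² = r
          -- makes -rc the square of cw and so σ = 1.
          ... | yes t≡r = trans
            (∑-cong elements λ x → ι-yes (c ⊗ (x ⊗ x) ⊗ (r ⊕ ⊖ ⊖ (c ⊗ (w ⊗ w))) ≟ 0#)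
              (trans (cong (λ t → c ⊗ (x ⊗ x) ⊗ (r ⊕ ⊖ t)) t≡r)
                (𝔽-solve 3 (λ c x r → c ⊠ (x ⊠ x) ⊠ (r ⊞ ⊟ r) ≋ 𝔽-con 0ℤ) refl c x r)))
            (trans (∑𝔽-const 1ℤ) (trans
              (solve 1 (λ q → q :* con 1ℤ := con 1ℤ :* con 1ℤ :+ con 1ℤ :* (q :- con 1ℤ) :* con 1ℤ :* con 1ℤ) refl q)
              (cong (λ s → 1ℤ * 1ℤ + s * (q - 1ℤ) * 1ℤ * 1ℤ) (sym σ≡1))))
            where
            -rc-square : (c ⊗ w) ⊗ (c ⊗ w) ≡ ⊖ (r ⊗ c)
            -rc-square = trans
              (𝔽-solve 2 (λ c w → (c ⊠ w) ⊠ (c ⊠ w) ≋ ⊟ (⊟ (c ⊠ (w ⊠ w)) ⊠ c)) refl c w)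
              (cong (λ r → ⊖ (r ⊗ c)) t≡r)

            σ≡1 : σ ≡ 1ℤ
            σ≡1 = cong (_- 1ℤ) (trans (cong roots (sym -rc-square)) (roots-square (root-≢0 -rc≢0 -rc-square)))
        section-formula (suc k) (α ∷ β ∷ w) with α ≟ 0# | β ≟ 0#
        ... | no α≢0   | _      = section-formula-suc k α≢0 β w
        ... | yes refl | no β≢0 = trans (sym (∑-points-swap k _)) (trans
          (∑-cong (points (suc k)) λ v → ∑-cong elements λ u → cong₂ (λ s t → ι (u ⊗ u ≟ r ⊗ s) * ι (t ≟ u ⊕ u))
            (Q-swap {k} v) (B-swap {k} v (β ∷ 0# ∷ w)))
          (trans (section-formula-suc k β≢0 0# w)
            (cong (λ t → pow (suc k) * pow (suc k) + σ * (q - 1ℤ) * pow (suc k) * ι (t ≟ r)) (Q-swap {k} (0# ∷ β ∷ w)))))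
        -- The hyperplane does not constrain (a , b), so these two sum out to a hyperbola over each
        -- (v , u); its generic part q - 1 then meets the single u with 2u = B(v , w).
        ... | yes refl | yes refl = trans (∑-points-suc k _) (trans (∑-rotate elements elements (points k) _) (trans
          (∑-cong (points k) fibre)
          (trans (∑-+ (points k) _ _) (trans
            (cong₂ _+_ (∑-points-const k (q - 1ℤ)) (trans (∑-*ˡ (points k) q _) (cong (q *_) (section-formula k w))))
            (trans (solve 4 (λ q p s i → q :* (p :* p) :* (q :- con 1ℤ) :+ q :* (p :* p :+ s :* (q :- con 1ℤ) :* p :* i) :=
                (q :* p) :* (q :* p) :+ s :* (q :- con 1ℤ) :* (q :* p) :* i) refl q (pow k) σ (ι (Qf {k} w ≟ r)))
              (cong (λ t → pow (suc k) * pow (suc k) + σ * (q - 1ℤ) * pow (suc k) * ι (t ≟ r))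
                (𝔽-solve 1 (λ t → t ≋ 𝔽-con 0ℤ ⊠ 𝔽-con 0ℤ ⊞ t) refl (Qf {k} w))))))))
          where
          split : ∀ v u →
            ∑𝔽 (λ a → ∑𝔽 λ b → ι (u ⊗ u ≟ r ⊗ Qf {suc k} (a ∷ b ∷ v)) * ι (B {suc k} (a ∷ b ∷ v) (0# ∷ 0# ∷ w) ≟ u ⊕ u)) ≡
            (q - 1ℤ) * ι (B {k} v w ≟ u ⊕ u) + q * (ι (u ⊗ u ≟ r ⊗ Qf {k} v) * ι (B {k} v w ≟ u ⊕ u))
          split v u = trans
            (∑-cong elements λ a → trans (∑-cong elements λ b → cong₂ _*_
                (cong (λ t → ι (u ⊗ u ≟ r ⊗ t)) (sym (𝔽.+-identityˡ _)))
                (cong (λ t → ι (t ≟ u ⊕ u)) (B-null-head {k} a b v w)))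
              (∑-*ʳ elements _ (ι (B {k} v w ≟ u ⊕ u))))
            (trans (∑-*ʳ elements _ (ι (B {k} v w ≟ u ⊕ u))) (trans
              (cong (_* ι (B {k} v w ≟ u ⊕ u)) (trans (hyperbola-fibre u 0# (Qf {k} v))
                (cong (λ t → (q - 1ℤ) + q * ι (u ⊗ u ≟ r ⊗ t)) (𝔽.+-identityˡ _))))
              (solve 3 (λ q i j → (q :- con 1ℤ :+ q :* i) :* j := (q :- con 1ℤ) :* j :+ q :* (i :* j)) refl
                q (ι (u ⊗ u ≟ r ⊗ Qf {k} v)) (ι (B {k} v w ≟ u ⊕ u)))))

          halves : ∀ y → ∑𝔽 (λ u → ι (y ≟ u ⊕ u)) ≡ 1ℤ
          halves y = trans
            (∑-cong elements λ u → ι-cong (y ≟ u ⊕ u) ((1# ⊕ 1#) ⊗ u ≟ y)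
              (λ e → trans (double u) (sym e)) (λ e → trans (sym e) (double u)))
            (∑𝔽-linear 2≢0 y)
            where
            double : ∀ u → (1# ⊕ 1#) ⊗ u ≡ u ⊕ u
            double u = 𝔽-solve 1 (λ u → (𝔽-con 1ℤ ⊞ 𝔽-con 1ℤ) ⊠ u ≋ u ⊞ u) refl u

          fibre : ∀ v →
            ∑𝔽 (λ a → ∑𝔽 λ b → ∑𝔽 λ u → ι (u ⊗ u ≟ r ⊗ Qf {suc k} (a ∷ b ∷ v)) * ι (B {suc k} (a ∷ b ∷ v) (0# ∷ 0# ∷ w) ≟ u ⊕ u)) ≡
            (q - 1ℤ) + q * ∑𝔽 (λ u → ι (u ⊗ u ≟ r ⊗ Qf {k} v) * ι (B {k} v w ≟ u ⊕ u))
          fibre v = trans (∑-rotate elements elements elements _) (trans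
            (∑-cong elements (split v)) (trans (∑-+ elements _ _)
              (cong₂ _+_ (trans (∑-*ˡ elements (q - 1ℤ) _)
                  (trans (cong ((q - 1ℤ) *_) (halves (B {k} v w))) (*-identityʳ (q - 1ℤ))))
                (∑-*ˡ elements q _))))

-- Correlation of hyperplane counts and the incidence bound.

module Incidence (F : FiniteField) where
  open import Data.List using (List; []; _∷_; length; cartesianProduct)
  open import Data.List.Membership.Propositional using (_∈_)
  open import Data.List.Relation.Unary.Any using (here)
  open import Data.List.Relation.Unary.Unique.Propositional using (Unique)
  open import Data.Nat as ℕ using (ℕ; zero; suc; z≤n; s≤s)
  import Data.Nat.Properties as ℕ
  open import Data.Product using (_×_; _,_)
  open import Data.Sum using (_⊎_; inj₁; inj₂)
  open import Data.Empty using (⊥-elim)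
  open import Data.Vec using ([]; _∷_)
  open import Data.Vec.Properties using (≡-dec)
  open import Relation.Nullary using (yes; no)
  open import Relation.Binary.Definitions using (DecidableEquality)
  open import Relation.Binary.PropositionalEquality
  import Data.Integer as ℤ
  import Data.Integer.Properties as ℤ
  open OpaqueIntegers
  open IntegerSums
  open QuadraticForms F

  _≟ᵥ_ : ∀ {k} → DecidableEquality (Point F k)
  _≟ᵥ_ = ≡-dec _≟_

  vsub-self : ∀ {k} (x : Point F k) → vsub F {k} x x ≡ 0ᵥ
  vsub-self {zero}  (x ∷ [])     = cong (_∷ []) (𝔽.-‿inverseʳ x)
  vsub-self {suc k} (x ∷ y ∷ v) = cong₂ _∷_ (𝔽.-‿inverseʳ x) (cong₂ _∷_ (𝔽.-‿inverseʳ y) (vsub-self {k} v))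

  vsub-zero : ∀ {k} {x y : Point F k} → vsub F {k} x y ≡ 0ᵥ → x ≡ y
  vsub-zero {zero} {_ ∷ []} {_ ∷ []} e = cong (_∷ []) (difference-zero (cong (λ { (a ∷ []) → a }) e))
  vsub-zero {suc k} {_ ∷ _ ∷ _} {_ ∷ _ ∷ _} e = cong₂ _∷_
    (difference-zero (cong (λ { (a ∷ _) → a }) e))
    (cong₂ _∷_ (difference-zero (cong (λ { (_ ∷ b ∷ _) → b }) e)) (vsub-zero {k} (cong (λ { (_ ∷ _ ∷ v) → v }) e)))

  2≤size : 2 ℕ.≤ size
  2≤size = go elements elements-complete
    where
    go : ∀ xs → (∀ x → x ∈ xs) → 2 ℕ.≤ length xs
    go []           m with m 0#
    ... | ()
    go (x ∷ [])     m with m 0# | m 1#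
    ... | here refl | here e = ⊥-elim (0≢1 (sym e))
    go (_ ∷ _ ∷ _) m = s≤s (s≤s z≤n)

  q-positive : Positive q
  q-positive with size | 2≤size
  ... | suc _ | s≤s _ = _

  q-1-positive : Positive (q - 1ℤ)
  q-1-positive with size | 2≤size
  ... | suc (suc _) | s≤s (s≤s _) = _

  pow-positive : ∀ k → Positive (pow k)
  pow-positive zero    = _
  pow-positive (suc k) = *-positive q-positive (pow-positive k)

  volume-^ : ∀ k → + (size ℕ.^ suc (dbl k)) ≡ volume k
  volume-^ zero    = trans (cong +_ (ℕ.*-identityʳ size)) (solve 1 (λ q → q := q :* (con 1ℤ :* con 1ℤ)) refl q)
  volume-^ (suc k) = trans (pos-* size _) (trans
    (cong (q *_) (trans (pos-* size (size ℕ.^ suc (dbl k))) (cong (q *_) (volume-^ k))))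
    (solve 2 (λ q p → q :* (q :* (q :* (p :* p))) := q :* ((q :* p) :* (q :* p))) refl q (pow k)))

  -- Both factors have sum zero over `s`, so apart from the constant -q only the coincidence of the
  -- two deltas survives. The vacuous shift by `0#` gives the factors the common shape required by
  -- `amplitude`.
  ∑-centred : ∀ a c h → ∑𝔽 (λ s → (q * ι (a ≟ s ⊕ h) - 1ℤ) * (q * ι (c ≟ s ⊕ 0#) - 1ℤ)) ≡
              q * (q * ι (a ≟ c ⊕ h) - 1ℤ)
  ∑-centred a c h = trans
    (∑-cong elements λ s → trans
      (cong (λ i → (q * ι (a ≟ s ⊕ h) - 1ℤ) * (q * i - 1ℤ)) (ι-cong (c ≟ s ⊕ 0#) (s ≟ c)
        (λ e → sym (trans e (𝔽.+-identityʳ s))) (λ e → trans (sym e) (sym (𝔽.+-identityʳ s)))))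
      (solve 3 (λ q i j → (q :* i :- con 1ℤ) :* (q :* j :- con 1ℤ) :=
        j :* (q :* q :* i :- q) :+ (:- q :* i :+ con 1ℤ)) refl q (ι (a ≟ s ⊕ h)) (ι (s ≟ c))))
    (trans (∑-+ elements _ _) (trans
      (cong₂ _+_ (∑-δ c λ s → q * q * ι (a ≟ s ⊕ h) - q)
        (trans (∑-*+const elements (- q) (λ s → ι (a ≟ s ⊕ h)) 1ℤ)
          (cong (λ i → - q * i + q * 1ℤ) (∑𝔽-unique (λ s → a ≟ s ⊕ h) (a ⊕ ⊖ h)
            (𝔽-solve 2 (λ a h → a ≋ a ⊞ ⊟ h ⊞ h) refl a h)
            λ s e → trans (𝔽-solve 2 (λ s h → s ≋ s ⊞ h ⊞ ⊟ h) refl s h) (cong (_⊕ ⊖ h) (sym e))))))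
      (solve 2 (λ q i → (q :* q :* i :- q) :+ (:- q :* con 1ℤ :+ q :* con 1ℤ) := q :* (q :* i :- con 1ℤ))
        refl q (ι (a ≟ c ⊕ h)))))

  module _ (c : Carrier) (c≢0 : c ≢ 0#) (2≢0 : 1# ⊕ 1# ≢ 0#) (k : ℕ) where
    open Form c
    open Nondegenerate c≢0 2≢0

    -- This is q times the excess, over the mean, of the number of entries of `X` on the hyperplane
    -- B(ξ , _) = s; the factor q keeps it integral.
    spectrum : List (Point F k) → Point F k → Carrier → ℤ
    spectrum X ξ s = ∑ X λ x → q * ι (B {k} ξ x ≟ s) - 1ℤ

    spectrum-correlation : ∀ X Y ξ h →
      ∑𝔽 (λ s → spectrum X ξ (s ⊕ h) * spectrum Y ξ (s ⊕ 0#)) ≡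
      ∑ X (λ x → ∑ Y λ y → q * (q * ι (B {k} ξ (vsub F {k} x y) ≟ h) - 1ℤ))
    spectrum-correlation X Y ξ h = trans
      (∑-cong elements λ s → ∑-*∑ X Y _ _)
      (trans (sym (∑-rotate X Y elements _)) (∑-cong X λ x → ∑-cong Y λ y → trans
        (∑-centred (B {k} ξ x) (B {k} ξ y) h)
        (cong (λ i → q * (q * i - 1ℤ)) (ι-difference (trans
          (𝔽-solve 3 (λ a c h → a ⊞ ⊟ (c ⊞ h) ≋ (a ⊞ ⊟ c) ⊞ ⊟ h) refl (B {k} ξ x) (B {k} ξ y) h)
          (cong (_⊕ ⊖ h) (sym (B-vsub {k} ξ x y))))))))

    -- Replaces the orthogonality of characters: for x ≠ y exactly one q-th of all ξ annihilate x -
    -- y, so the centred indicators cancel.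
    centred-hyperplane-sum : ∀ (x y : Point F k) →
      ∑ (points k) (λ ξ → q * ι (B {k} ξ (vsub F {k} x y) ≟ 0#) - 1ℤ) ≡ (q - 1ℤ) * volume k * ι (y ≟ᵥ x)
    centred-hyperplane-sum x y = trans (∑-points-linear k q _ (- 1ℤ)) count
      where
      count : q * ∑ (points k) (λ ξ → ι (B {k} ξ (vsub F {k} x y) ≟ 0#)) + volume k * - 1ℤ ≡
              (q - 1ℤ) * volume k * ι (y ≟ᵥ x)
      count with y ≟ᵥ x
      ... | yes refl = trans
        (cong (λ N → q * N + volume k * - 1ℤ) (trans
          (∑-cong (points k) λ ξ → ι-yes (B {k} ξ (vsub F {k} y y) ≟ 0#)
            (trans (cong (B {k} ξ) (vsub-self {k} y)) (B-0ᵥ {k} ξ)))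
          (∑-points-const k 1ℤ)))
        (solve 2 (λ q V → q :* (V :* con 1ℤ) :+ V :* :- con 1ℤ := (q :- con 1ℤ) :* V :* con 1ℤ) refl q (volume k))
      ... | no y≢x with hyperplane-count k (vsub F {k} x y)
      ...   | inj₁ e = ⊥-elim (y≢x (sym (vsub-zero {k} e)))
      ...   | inj₂ N = trans (cong (λ N → q * N + volume k * - 1ℤ) (N 0#))
        (solve 2 (λ q p → q :* (p :* p) :+ q :* (p :* p) :* :- con 1ℤ :=
          (q :- con 1ℤ) :* (q :* (p :* p)) :* con 0ℤ) refl q (pow k))

    -- The correlation at `h = 0#` expands the square into pairs, and orthogonality over ξ leaves
    -- the diagonal ones, `length X` in number as `X` has no repetitions.
    parseval : ∀ {X} → Unique X →
      ∑ (points k) (λ ξ → ∑𝔽 λ s → spectrum X ξ s * spectrum X ξ s) ≡ q * ((q - 1ℤ) * volume k) * + length X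
    parseval {X} unique = trans
      (∑-cong (points k) λ ξ → trans
        (∑-cong elements λ s → cong (λ s → spectrum X ξ s * spectrum X ξ s) (sym (𝔽.+-identityʳ s)))
        (spectrum-correlation X X ξ 0#))
      (trans (sym (∑-rotate X X (points k) _)) (trans
        (∑-cong X λ x → trans
          (∑-cong X λ y → trans (∑-*ˡ (points k) q _) (trans (cong (q *_) (centred-hyperplane-sum x y))
            (solve 3 (λ q d i → q :* (d :* i) := q :* d :* i) refl q ((q - 1ℤ) * volume k) (ι (y ≟ᵥ x)))))
          (∑-*ˡ X (q * ((q - 1ℤ) * volume k)) _))
        (trans (∑-*ˡ X (q * ((q - 1ℤ) * volume k)) _)
          (cong (q * ((q - 1ℤ) * volume k) *_) (∑-diagonal _≟ᵥ_ unique)))))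

    module _ (r : Carrier) (r≢0 : r ≢ 0#) where
      open Sphere r r≢0

      cone : Point F k → Carrier → ℤ
      cone ξ u = ι (u ⊗ u ≟ r ⊗ Qf {k} ξ)

      frequencies : List (Point F k × Carrier × Carrier)
      frequencies = cartesianProduct (points k) (cartesianProduct elements elements)

      ∑-frequencies : ∀ f → ∑ frequencies f ≡ ∑ (points k) (λ ξ → ∑𝔽 λ u → ∑𝔽 λ s → f (ξ , u , s))
      ∑-frequencies f = trans (∑-cartesianProduct (points k) _ f)
        (∑-cong (points k) λ ξ → ∑-cartesianProduct elements elements _)

      -- The offset `d u` is 2u for the points and zero for the centers, so that correlating the two
      -- over `s` tests B(ξ , x - y) = 2u.
      amplitude : List (Point F k) → (Carrier → Carrier) → Point F k × Carrier × Carrier → ℤ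
      amplitude X d (ξ , u , s) = cone ξ u * spectrum X ξ (s ⊕ d u)

      -- Translating `s` removes the offset, so each u above ξ contributes the same energy. There
      -- are at most two such u, and Parseval evaluates the rest.
      energy-bound : ∀ {X} d → Unique X →
        ∑ frequencies (λ ω → amplitude X d ω * amplitude X d ω) ≤ + 2 * (q * ((q - 1ℤ) * volume k) * + length X)
      energy-bound {X} d unique = ≤-trans
        (≤-reflexive (trans (∑-frequencies _) (∑-cong (points k) λ ξ → trans
          (∑-cong elements λ u → along ξ u) (∑-*ʳ elements (cone ξ) (energy ξ)))))
        (≤-trans (∑-mono (points k) λ ξ → *-monoˡ-≤ (energy ξ)
            (∑-nonneg elements λ s → square-nonneg (spectrum X ξ s)) (roots-≤2 (r ⊗ Qf {k} ξ)))
          (≤-reflexive (trans (∑-*ˡ (points k) (+ 2) energy) (cong (+ 2 *_) (parseval unique)))))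
        where
        energy : Point F k → ℤ
        energy ξ = ∑𝔽 λ s → spectrum X ξ s * spectrum X ξ s

        along : ∀ ξ u → ∑𝔽 (λ s → amplitude X d (ξ , u , s) * amplitude X d (ξ , u , s)) ≡ cone ξ u * energy ξ
        along ξ u = trans
          (∑-cong elements λ s → trans
            (solve 2 (λ i x → i :* x :* (i :* x) := i :* i :* (x :* x)) refl (cone ξ u) (spectrum X ξ (s ⊕ d u)))
            (cong (_* (spectrum X ξ (s ⊕ d u) * spectrum X ξ (s ⊕ d u))) (ι-*-idem (u ⊗ u ≟ r ⊗ Qf {k} ξ))))
          (trans (∑-*ˡ elements (cone ξ u) _)
            (cong (cone ξ u *_) (∑𝔽-translate (d u) λ s → spectrum X ξ s * spectrum X ξ s)))

      discrepancy : List (Point F k) → List (Point F k) → ℤ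
      discrepancy X Y = ∑ X λ x → ∑ Y λ y → q * ι (Qf {k} (vsub F {k} x y) ≟ r) - 1ℤ

      -- From q² times the section count, q times the size of the cone is subtracted. The main terms
      -- q²p² cancel, and the deviations σ(q - 1)p of section and cone combine into the centred
      -- indicator of the sphere.
      cone-sum : ∀ (w : Point F k) →
        ∑ (points k) (λ ξ → ∑𝔽 λ u → cone ξ u * (q * (q * ι (B {k} ξ w ≟ u ⊕ u) - 1ℤ))) ≡
        q * (σ * (q - 1ℤ) * pow k) * (q * ι (Qf {k} w ≟ r) - 1ℤ)
      cone-sum w = trans
        (∑-cong (points k) λ ξ → trans
          (∑-cong elements λ u → solve 3 (λ q i j → i :* (q :* (q :* j :- con 1ℤ)) := q :* q :* (i :* j) :+ :- q :* i)
            refl q (cone ξ u) (ι (B {k} ξ w ≟ u ⊕ u)))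
          (trans (∑-+ elements _ _) (cong₂ _+_ (∑-*ˡ elements (q * q) _) (∑-*ˡ elements (- q) (cone ξ)))))
        (trans (∑-+ (points k) _ _) (trans
          (cong₂ _+_
            (trans (∑-*ˡ (points k) (q * q) _) (cong (q * q *_) (section-formula k w)))
            (trans (∑-*ˡ (points k) (- q) _) (cong (- q *_) (trans
              (∑-cong (points k) λ ξ → cong (λ t → roots (r ⊗ t)) (sym (𝔽.+-identityˡ _)))
              (coneCount-0 k)))))
          (solve 4 (λ q p s i →
            q :* q :* (p :* p :+ s :* (q :- con 1ℤ) :* p :* i) :+ :- q :* (q :* (p :* p) :+ p :* (s :* (q :- con 1ℤ))) :=
            q :* (s :* (q :- con 1ℤ) :* p) :* (q :* i :- con 1ℤ)) refl q (pow k) σ (ι (Qf {k} w ≟ r)))))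

      discrepancy-expansion : ∀ X Y →
        ∑ frequencies (λ ω → amplitude X (λ u → u ⊕ u) ω * amplitude Y (λ _ → 0#) ω) ≡
        q * (σ * (q - 1ℤ) * pow k) * discrepancy X Y
      discrepancy-expansion X Y = trans (∑-frequencies _) (trans
        (∑-cong (points k) λ ξ → ∑-cong elements λ u → trans
          (∑-cong elements λ s → trans
            (solve 3 (λ i x y → i :* x :* (i :* y) := i :* i :* (x :* y)) refl
              (cone ξ u) (spectrum X ξ (s ⊕ (u ⊕ u))) (spectrum Y ξ (s ⊕ 0#)))
            (cong (_* (spectrum X ξ (s ⊕ (u ⊕ u)) * spectrum Y ξ (s ⊕ 0#))) (ι-*-idem (u ⊗ u ≟ r ⊗ Qf {k} ξ))))
          (trans (∑-*ˡ elements (cone ξ u) _) (trans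
            (cong (cone ξ u *_) (spectrum-correlation X Y ξ (u ⊕ u)))
            (trans (sym (∑-*ˡ X (cone ξ u) _)) (∑-cong X λ x → sym (∑-*ˡ Y (cone ξ u) _))))))
        (trans
          (∑-cong (points k) λ ξ → sym (∑-rotate X Y elements _))
          (trans (sym (∑-rotate X Y (points k) _)) (trans
            (∑-cong X λ x → trans (∑-cong Y λ y → cone-sum (vsub F {k} x y)) (∑-*ˡ Y _ _))
            (∑-*ˡ X _ _)))))

      discrepancy-bound : ∀ {X Y} → Unique X → Unique Y →
        discrepancy X Y * discrepancy X Y ≤ + 4 * (q * volume k * + length Y * + length X)
      discrepancy-bound {X} {Y} unique-X unique-Y =
        *-cancelˡ-≤ scale scale-positive (≤-trans (≤-reflexive left) (≤-trans
          (cauchy-schwarz frequencies (amplitude X (λ u → u ⊕ u)) (amplitude Y (λ _ → 0#)))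
          (≤-trans (*-mono-≤ (∑-nonneg frequencies λ ω → square-nonneg (amplitude Y (λ _ → 0#) ω))
              (≤-trans (∑-nonneg frequencies λ ω → square-nonneg (amplitude X (λ u → u ⊕ u) ω)) (energy-bound (λ u → u ⊕ u) unique-X))
              (energy-bound (λ u → u ⊕ u) unique-X) (energy-bound (λ _ → 0#) unique-Y))
            (≤-reflexive right))))
        where
        -- The left side carries (q(q - 1)p)² and the right side 4(q(q - 1) `volume k`)². As
        -- (`volume k`)² = q `volume k` p², cancelling leaves 4q `volume k`.
        scale : ℤ
        scale = (q * (q - 1ℤ) * pow k) * (q * (q - 1ℤ) * pow k)

        scale-positive : Positive scale
        scale-positive = *-positive base base
          where
          base : Positive (q * (q - 1ℤ) * pow k)
          base = *-positive (*-positive q-positive q-1-positive) (pow-positive k)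

        D : ℤ
        D = discrepancy X Y

        left : scale * (D * D) ≡
          ∑ frequencies (λ ω → amplitude X (λ u → u ⊕ u) ω * amplitude Y (λ _ → 0#) ω) *
          ∑ frequencies (λ ω → amplitude X (λ u → u ⊕ u) ω * amplitude Y (λ _ → 0#) ω)
        left = trans
          (solve 3 (λ q p D → (q :* (q :- con 1ℤ) :* p) :* (q :* (q :- con 1ℤ) :* p) :* (D :* D) :=
            con 1ℤ :* ((q :* (q :- con 1ℤ) :* p) :* (q :* (q :- con 1ℤ) :* p) :* (D :* D))) refl q (pow k) D)
          -- The factor 1 is replaced by σ², which completes the square of the expanded discrepancy
          -- whatever the sign σ.
          (trans (cong (_* (scale * (D * D))) (sym σ-square)) (trans
            (solve 4 (λ q p s D → s :* s :* ((q :* (q :- con 1ℤ) :* p) :* (q :* (q :- con 1ℤ) :* p) :* (D :* D)) :=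
              (q :* (s :* (q :- con 1ℤ) :* p) :* D) :* (q :* (s :* (q :- con 1ℤ) :* p) :* D)) refl q (pow k) σ D)
            (cong (λ z → z * z) (sym (discrepancy-expansion X Y)))))

        right : + 2 * (q * ((q - 1ℤ) * volume k) * + length X) * (+ 2 * (q * ((q - 1ℤ) * volume k) * + length Y)) ≡
                scale * (+ 4 * (q * volume k * + length Y * + length X))
        right = solve 4 (λ q p n m →
          con (+ 2) :* (q :* ((q :- con 1ℤ) :* (q :* (p :* p))) :* n) :* (con (+ 2) :* (q :* ((q :- con 1ℤ) :* (q :* (p :* p))) :* m)) :=
          (q :* (q :- con 1ℤ) :* p) :* (q :* (q :- con 1ℤ) :* p) :* (con (+ 4) :* (q :* (q :* (p :* p)) :* m :* n)))
          refl q (pow k) (+ length X) (+ length Y)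

  incidence-discrepancy : ∀ ε i c≢0 2≢0 k r r≢0 (X Y : List (Point F k)) →
    discrepancy (coeff F ε i) c≢0 2≢0 k r r≢0 X Y ≡
    + (size ℕ.* incidences F k ε i r X Y) - + (length X ℕ.* length Y)
  incidence-discrepancy ε i c≢0 2≢0 k r r≢0 X Y = trans
    (∑-cong X λ x → ∑-*+const Y q (hit x) (- 1ℤ))
    (trans (∑-*+const X q (λ x → ∑ Y (hit x)) (+ length Y * - 1ℤ)) (trans
      (solve 4 (λ q I n m → q :* I :+ n :* (m :* :- con 1ℤ) := q :* I :- n :* m) refl q _ (+ length X) (+ length Y))
      (cong₂ _-_ (trans (cong (q *_) (sym count)) (sym (pos-* size _))) (sym (pos-* (length X) (length Y))))))
    where
    hit : Point F k → Point F k → ℤ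
    hit x y = ι (Q F k ε i (vsub F {k} x y) ≟ r)

    count : + incidences F k ε i r X Y ≡ ∑ X (λ x → ∑ Y (hit x))
    count = trans (∑-sum _ X) (∑-cong X λ x → ∑-filter (λ y → Q F k ε i (vsub F {k} x y) ≟ r) Y)

  coeff-≢0 : ∀ {ε} → ε ≢ 0# → ∀ {i} → i ≡ 3 ⊎ i ≡ 4 → coeff F ε i ≢ 0#
  coeff-≢0 ε≢0 (inj₁ refl) e = 0≢1 (sym e)
  coeff-≢0 ε≢0 (inj₂ refl) e = ε≢0 e

  -- The estimate has constant 4 = 2² and 9 = 3² is wanted; the inequality becomes strict because
  -- q^(d+1)mn is positive.
  strengthen : ∀ k {n m : ℕ} → 1 ℕ.≤ n → 1 ℕ.≤ m → ∀ D → D * D ≤ + 4 * (q * volume k * + m * + n) →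
               D ℤ.* D ℤ.< + (9 ℕ.* (size ℕ.^ (suc (dbl k) ℕ.+ 1)) ℕ.* m ℕ.* n)
  strengthen k {suc n} {suc m} _ _ D bound = ℤ.≤-<-trans
    (subst₂ _≤_ (*-unfold D D) (trans (cong (+ 4 *_) (sym product)) (sym (pos-* 4 N))) bound)
    (subst (λ M → + (4 ℕ.* N) ℤ.< + M) (trans (sym (ℕ.*-assoc 9 (power ℕ.* suc m) (suc n))) (cong (ℕ._* suc n) (sym (ℕ.*-assoc 9 power (suc m)))))
      (ℤ.+<+ (ℕ.*-monoˡ-< N {{nonZero}} {4} {9} (s≤s (s≤s (s≤s (s≤s (s≤s z≤n))))))))
    where
    power N : ℕ
    power = size ℕ.^ (suc (dbl k) ℕ.+ 1)
    N     = power ℕ.* suc m ℕ.* suc n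

    product : + N ≡ q * volume k * + suc m * + suc n
    product = trans (pos-* (power ℕ.* suc m) (suc n)) (cong (_* + suc n) (trans (pos-* power (suc m)) (cong (_* + suc m)
      (trans (cong (λ e → + (size ℕ.^ e)) (ℕ.+-comm (suc (dbl k)) 1))
        (trans (pos-* size _) (cong (q *_) (volume-^ k)))))))

    nonZero : ℕ.NonZero N
    nonZero = positive⇒nonZero (subst Positive (sym product) (*-positive {j = + suc n} (*-positive {j = + suc m}
      (*-positive q-positive (*-positive q-positive (*-positive (pow-positive k) (pow-positive k)))) _) _))
      where
      positive⇒nonZero : ∀ {n} → Positive (+ n) → ℕ.NonZero n
      positive⇒nonZero {suc _} _ = _

  incidence-bound : ∀ ε → (∀ a → a ⊗ a ≢ ε) → ∀ k {i} → i ≡ 3 ⊎ i ≡ 4 → ∀ {r} → r ≢ 0# →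
    ∀ {X Y} → 1 ℕ.≤ length X → 1 ℕ.≤ length Y → Unique X → Unique Y →
    let Δ = + (size ℕ.* incidences F k ε i r X Y) - + (length X ℕ.* length Y)
    in Δ ℤ.* Δ ℤ.< + (9 ℕ.* (size ℕ.^ (suc (dbl k) ℕ.+ 1)) ℕ.* length Y ℕ.* length X)
  incidence-bound ε nonsquare k {i} i∈ {r} r≢0 {X} {Y} 1≤|X| 1≤|Y| unique-X unique-Y =
    strengthen k 1≤|X| 1≤|Y| _ (subst (λ D → D * D ≤ + 4 * (q * volume k * + length Y * + length X))
      (incidence-discrepancy ε i c≢0 2≢0 k r r≢0 X Y)
      (discrepancy-bound (coeff F ε i) c≢0 2≢0 k r r≢0 unique-X unique-Y))
    where
    2≢0 : 1# ⊕ 1# ≢ 0#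
    2≢0 = nonsquare⇒2≢0 nonsquare

    c≢0 : coeff F ε i ≢ 0#
    c≢0 = coeff-≢0 (λ e → nonsquare 0# (trans (𝔽.zeroˡ 0#) (sym e))) i∈

open import Data.Nat using (ℕ; suc; _*_; _^_; _≤_; _+_; _%_)
open import Data.Integer as ℤ using (ℤ; +_)
open import Data.List using (List; length)
open import Data.List.Relation.Unary.Unique.Propositional using (Unique)
open import Data.Sum using (_⊎_)
open import Relation.Binary.PropositionalEquality using (_≡_; refl)
open import Relation.Nullary using (¬_)

-- To stay within the integers, the inequality is multiplied by q and squared, which turns 3q ·
-- q^((d-1)/2) into 9q^(d+1). Quantifying over all admissible `P` and `centers` expresses the
-- maximum; a sphere of the fixed radius is given by its center.
theorem4p3 : (F : FiniteField) →
  (FiniteField.size F % 2 ≡ 1) →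
  (ε : FiniteField.Carrier F) →
  (∀ a → ¬ (FiniteField._*_ F a a ≡ ε)) →
  (k : ℕ) → (i : ℕ) → (i ≡ 3 ⊎ i ≡ 4) →
  (n m : ℕ) → 1 ≤ n → 1 ≤ m →
  (r : FiniteField.Carrier F) → ¬ (r ≡ FiniteField.0# F) →
  (P : List (Point F k)) → Unique P → length P ≡ n →
  (centers : List (Point F k)) → Unique centers → length centers ≡ m →
  let q = FiniteField.size F
      d = suc (dbl k)
      Δ = (+ (q * incidences F k ε i r P centers)) ℤ.- (+ (n * m))
  in (Δ ℤ.* Δ) ℤ.< + (9 * (q ^ (d + 1)) * m * n)
theorem4p3 F _ ε nonsquare k i i∈ n m 1≤n 1≤m r r≢0 P P-unique refl centers centers-unique refl =
  Incidence.incidence-bound F ε nonsquare k i∈ r≢0 1≤n 1≤m P-unique centers-unique
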